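{- Let $m\ge1$ be an integer, let $a$ be real, and let $F_m$ be a real polynomial of degree $m$ with $F_m(0)=1$ whose zeros are $-\alpha_1,\ldots,-\alpha_m$ (repeated according to multiplicity). Suppose $a+m<1$ and $\alpha_j>0$ for $j=1,\ldots,m$. Then all zeros of the $F_m$-Eulerian polynomial $\hat{w}(a;F_m\,|\,x)$ or, equivalently, of the hypergeometric function $\sum_{n\ge0}F_m(n)\frac{(a)_n}{n!}x^n$, are real and lie in the interval $(0,1)$. If (still with $\alpha_j>0$ for $j=1,\ldots,m$) $1\le a+m<2$, then all zeros but one lie in $(0,1)$, plus one zero lies in $[1,\infty)$.
   Context: $(a)_n=a(a+1)\cdots(a+n-1)$, $(a)_0=1$, is the Pochhammer symbol. For real $a$ and a polynomial $F_m$ of degree $m$ with $F_m(0)=1$, the $F_m$-Eulerian polynomial $\hat{w}(x)=\hat{w}(a;F_m\,|\,x)$ is the polynomial in $x$ of degree at most $m$ defined by $$\sum_{n=0}^{\infty}F_m(n)\frac{(a)_n}{n!}x^n=\frac{\hat{w}(a;F_m\,|\,x)}{(1-x)^{m+a}},$$ where powers of $1-x$ are understood as power series at $0$. The left-hand side is a generalized hypergeometric function: writing $F_m(t)=\prod_{i=1}^r (f_i+t)_{m_i}/(f_i)_{m_i}$ with positive integers $m_i$, $m_1+\cdots+m_r=m$, it equals ${}_{r+1}F_r$ with top parameters $a,f_1+m_1,\ldots,f_r+m_r$ and bottom parameters $f_1,\ldots,f_r$. Zeros are counted with multiplicity.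
   Formalization: In the second part the formal statement also assumes a < α_j for all j. This is automatic for m ≥ 2; for m = 1 and a ≥ α_1 the claim is false, since the polynomial is then 1 + (a/α_1 − 1)x, with a negative zero or none. -}

module Defs where

open import Algebra.Bundles using (CommutativeRing; RawSemiring; Semiring)
import Algebra.Definitions.RawSemiring as RawSemiringDefs
open import Data.Fin.Base using (Fin; toℕ)
open import Data.List.Base using (List; foldr; tabulate)
open import Data.List.Relation.Unary.All using (All)
open import Data.Nat.Base as ℕ using (ℕ; zero; suc; _∸_; _!)
open import Data.Product.Base using (∃; ∃-syntax; _×_)
open import Data.Vec.Base using (Vec; []; _∷_)
open import Level using (0ℓ)
open import Relation.Binary.Core using (Rel)
open import Relation.Binary.Structures using (IsStrictTotalOrder)
import Relation.Binary.Construct.StrictToNonStrict as StrictToNonStrict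
open import Relation.Nullary.Negation.Core using (¬_)

-- The real numbers, characterised up to isomorphism as a Dedekind-complete
-- ordered field.

record CompleteOrderedField : Set₁ where
  infix  4 _<_
  infix  8 _⁻¹

  field
    commutativeRing : CommutativeRing 0ℓ 0ℓ

  open CommutativeRing commutativeRing public

  field
    1≉0                : 1# ≉ 0#
    _⁻¹                : Carrier → Carrier
    ⁻¹-inverseʳ        : ∀ x → x ≉ 0# → x * x ⁻¹ ≈ 1#
    _<_                : Rel Carrier 0ℓ
    isStrictTotalOrder : IsStrictTotalOrder _≈_ _<_
    +-monoˡ-<          : ∀ z {x y} → x < y → x + z < y + z
    *-pos              : ∀ {x y} → 0# < x → 0# < y → 0# < x * y

  open StrictToNonStrict _≈_ _<_ public using (_≤_)

  UpperBound : (Carrier → Set) → Carrier → Set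
  UpperBound P b = ∀ x → P x → x ≤ b

  field
    supremum : ∀ (P : Carrier → Set) → ∃ P → ∃ (UpperBound P) →
               ∃[ s ] (UpperBound P s × (∀ b → UpperBound P b → s ≤ b))

module Eulerian (ℝ : CompleteOrderedField) where

  open CompleteOrderedField ℝ hiding (zero)
  open RawSemiringDefs (Semiring.rawSemiring semiring) using (sum) renaming (_×_ to _×ᴿ_)

  fromℕ : ℕ → Carrier
  fromℕ n = n ×ᴿ 1#

  -- Complex numbers

  infix 5 _+i_

  record ℂ : Set where
    constructor _+i_
    field
      re im : Carrier

  open ℂ public

  infix  4 _≈ᶜ_
  infixl 6 _+ᶜ_ _-ᶜ_
  infixl 7 _*ᶜ_
  infix  8 -ᶜ_

  _≈ᶜ_ : Rel ℂ 0ℓ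
  u ≈ᶜ v = (re u ≈ re v) × (im u ≈ im v)

  _+ᶜ_ _-ᶜ_ _*ᶜ_ : ℂ → ℂ → ℂ
  u +ᶜ v = (re u + re v) +i (im u + im v)
  u -ᶜ v = (re u - re v) +i (im u - im v)
  u *ᶜ v = (re u * re v - im u * im v) +i (re u * im v + im u * re v)

  -ᶜ_ : ℂ → ℂ
  -ᶜ u = (- re u) +i (- im u)

  ι : Carrier → ℂ
  ι x = x +i 0#

  0ᶜ 1ᶜ : ℂ
  0ᶜ = ι 0#
  1ᶜ = ι 1#

  ∣_∣² : ℂ → Carrier
  ∣ u ∣² = re u * re u + im u * im u

  ℂ-rawSemiring : RawSemiring 0ℓ 0ℓ
  ℂ-rawSemiring = record
    { Carrier = ℂ ; _≈_ = _≈ᶜ_ ; _+_ = _+ᶜ_ ; _*_ = _*ᶜ_ ; 0# = 0ᶜ ; 1# = 1ᶜ }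

  open RawSemiringDefs ℂ-rawSemiring public using ()
    renaming (sum to sumᶜ; _^_ to _^ᶜ_)

  InUnitDisc : ℂ → Set
  InUnitDisc z = ∣ z ∣² < 1#

  -- z is real and satisfies P.
  RealAnd : (Carrier → Set) → ℂ → Set
  RealAnd P z = ∃[ x ] (z ≈ᶜ ι x × P x)

  ⟨0,1⟩ [1,∞⟩ : Carrier → Set
  ⟨0,1⟩ x = 0# < x × x < 1#
  [1,∞⟩ x = 1# ≤ x

  -- Real polynomials of degree at most m: coefficients in increasing order of
  -- powers.

  Poly : ℕ → Set
  Poly m = Vec Carrier (suc m)

  coeff : ∀ {k} → Vec Carrier k → ℕ → Carrier
  coeff []      _       = 0#
  coeff (c ∷ p) zero    = c
  coeff (c ∷ p) (suc n) = coeff p n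

  eval : ∀ {k} → Vec Carrier k → Carrier → Carrier
  eval []      x = 0#
  eval (c ∷ p) x = c + x * eval p x

  ExactDegree : ∀ m → Poly m → Set
  ExactDegree m p = coeff p m ≉ 0#

  -- Formal power series over ℂ and their sums

  Seriesᶜ : Set
  Seriesᶜ = ℕ → ℂ

  constant : ℂ → Seriesᶜ
  constant c zero    = c
  constant c (suc _) = 0ᶜ

  partialSum : Seriesᶜ → ℂ → ℕ → ℂ
  partialSum f z n = sumᶜ {n} (λ k → f (toℕ k) *ᶜ z ^ᶜ toℕ k)

  -- ∑ f(n) zⁿ converges to v.
  HasSum : Seriesᶜ → ℂ → ℂ → Set
  HasSum f z v = ∀ ε → 0# < ε →
    ∃[ N ] (∀ n → N ℕ.≤ n → ∣ partialSum f z n -ᶜ v ∣² < ε * ε)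

  -- (X − z) · f
  linearTimes : ℂ → Seriesᶜ → Seriesᶜ
  linearTimes z f zero    = -ᶜ (z *ᶜ f zero)
  linearTimes z f (suc n) = f n -ᶜ z *ᶜ f (suc n)

  -- f · ∏ (X − z), the product running over the list.
  withZeros : List ℂ → Seriesᶜ → Seriesᶜ
  withZeros zs f = foldr linearTimes f zs

  -- zs lists all complex zeros of p with multiplicity: p = c · ∏ (X − z), c ≠ 0.
  ZerosOf : ∀ {m} → Poly m → List ℂ → Set
  ZerosOf p zs = ∃[ c ] (¬ (c ≈ᶜ 0ᶜ) ×
    (∀ n → ι (coeff p n) ≈ᶜ withZeros zs (constant c) n))

  ZeroFreeOnDisc : Seriesᶜ → Set
  ZeroFreeOnDisc g = ∀ z → InUnitDisc z → ∃[ v ] (¬ (v ≈ᶜ 0ᶜ) × HasSum g z v)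

  -- zs lists, with multiplicity, all zeros in the open unit disc of the analytic
  -- function x ↦ ∑ f(n) xⁿ: this function is ∏ (x − z) times an analytic function
  -- without zeros in the disc.
  DiscZerosOf : (ℕ → Carrier) → List ℂ → Set
  DiscZerosOf f zs = All InUnitDisc zs × ∃[ g ] (ZeroFreeOnDisc g ×
    (∀ n → ι (f n) ≈ᶜ withZeros zs g n))

  pochhammer : Carrier → ℕ → Carrier
  pochhammer a zero    = 1#
  pochhammer a (suc n) = pochhammer a n * (a + fromℕ n)

  -- Coefficients (s)ₙ / n! of the binomial series of (1 − x)⁻ˢ.
  binomialSeries : Carrier → ℕ → Carrier
  binomialSeries s n = pochhammer s n * fromℕ (n !) ⁻¹

  hypergeometric : ∀ {m} → Carrier → Poly m → ℕ → Carrier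
  hypergeometric a F n = eval F (fromℕ n) * binomialSeries a n

  cauchyProduct : (ℕ → Carrier) → (ℕ → Carrier) → ℕ → Carrier
  cauchyProduct f g n = sum {suc n} (λ k → f (toℕ k) * g (n ∸ toℕ k))

  -- ŵ is the F-Eulerian polynomial: as formal power series,
  -- ∑ F(n) (a)ₙ/n! xⁿ = ŵ(x) (1 − x)^(−(m+a)).  Since (1 − x)^(−(m+a)) is
  -- invertible, this determines ŵ.
  IsEulerian : ∀ {m} → Carrier → Poly m → Poly m → Set
  IsEulerian {m} a F ŵ = ∀ n →
    hypergeometric a F n ≈
    cauchyProduct (coeff ŵ) (binomialSeries (fromℕ m + a)) n

  -- The zeros of F, with multiplicity, are −α₁, …, −αₘ.
  HasZerosAtNegatives : ∀ {m} → Poly m → (Fin m → Carrier) → Set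
  HasZerosAtNegatives F α = ZerosOf F (tabulate (λ j → ι (- α j)))

module Submission where

-- Write F(x) = γ ∏ (x + αⱼ) with γ > 0.  The series ∑ F(n) (a)ₙ/n! xⁿ arises from
-- γ (1 - x)^(-a) by applying the operators αⱼ + x d/dx one after the other.  If s = k + a
-- and p is a polynomial, then
--   (α + x d/dx) (p (1 - x)^(-s)) = p⁺ (1 - x)^(-(s+1)),
--   p⁺ = (1 - x) (α p + x p′) + s x p,
-- so the Eulerian polynomial is obtained from the constant γ by m steps p ↦ p⁺
-- (step-⊛, eulerian-⊛); it is determined by the power series identity because
-- (1 - x)^(-(m+a)) has constant term 1 (⊛-cancelʳ).
--
-- Let p = c ∏ (rᵢ - x) with c > 0 and 0 < r₁ < … < r_k < 1.  Then p⁺(0) = α p(0) > 0,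
-- p⁺(rᵢ) = rᵢ (1 - rᵢ) p′(rᵢ) has sign (-1)ⁱ, and p⁺(1) = s p(1).
--  * If s < 0, then p⁺ changes sign k + 1 times along 0, r₁, …, r_k, 1, so it has
--    k + 1 simple zeros in (0,1), and it has degree at most k + 1 (step-negative).
--    When a + m < 1 all m steps are of this kind.
--  * If s ≥ 0, there are still k zeros in (0,1).  The remaining linear factor q₀ + q₁ x
--    has q₁ < 0 when α > a, from the leading coefficient, and q₀ + q₁ ≥ 0, from the
--    value at 1, so its zero is at least 1 (step-nonnegative).  When 1 ≤ a + m < 2 the
--    last step is of this kind and the others have s < 0.
-- Zeros come from the intermediate value theorem, which follows from the existence of
-- suprema, and are split off by synthetic division (alternating-roots, factor).
--
-- The hypergeometric function is the Eulerian polynomial times (1 - x)^(-(m+a)), and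
-- the latter has no zeros in the unit disc: its binomial series is dominated there by a
-- geometric one, hence converges, and its Cauchy product with the series of
-- (1 - x)^(m+a) is 1, so its sum is not 0 (binomialSeries-inverse, nonzero-sum,
-- binomial-sum).

open import Defs
open import Algebra.Bundles using (CommutativeRing; Semiring)
open import Axiom.ExcludedMiddle using (ExcludedMiddle)
open import Data.Fin.Base as Fin using (Fin; toℕ)
open import Data.Integer.Base as ℤ using (ℤ; +_; -[1+_]; _⊖_)
import Data.Integer.Properties as ℤ
open import Data.List.Base using (List; []; _∷_; _++_; foldr; length; map; tabulate)
import Data.List.Properties as List
open import Data.List.Relation.Unary.All as All using (All; []; _∷_)
open import Data.List.Relation.Unary.All.Properties using (++⁺; map⁺)
open import Data.Maybe.Base using (just; nothing)
open import Data.Nat.Base as ℕ using (ℕ; zero; suc; _∸_; _!)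
import Data.Nat.Properties as ℕ
open import Data.Product.Base using (∃-syntax; _×_; _,_; proj₁; proj₂)
import Data.Sign.Base as Sign
open import Data.Sum.Base using (inj₁; inj₂; [_,_]′)
open import Data.Unit.Base using (⊤; tt)
open import Data.Vec.Base using (Vec; []; _∷_)
open import Function.Base using (_∘_)
open import Level using (0ℓ)
open import Relation.Binary.Definitions using (WeaklyDecidable; tri<; tri≈; tri>)
open import Relation.Binary.PropositionalEquality.Core as ≡ using (_≡_)
open import Relation.Binary.Structures using (IsStrictTotalOrder)
open import Relation.Nullary.Decidable.Core using (yes; no)
open import Relation.Nullary.Negation.Core using (¬_; contradiction)

-- Ring solving with integer coefficients

-- The ring solver for an arbitrary commutative ring.  Coefficients are taken in ℤ,
-- where equality is decidable, so that cancelling terms are recognised.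
module IntegerSolver {c ℓ} (R : CommutativeRing c ℓ) where

  open CommutativeRing R renaming (zero to *-zero)
  open import Algebra.Properties.Ring ring
  open import Algebra.Properties.AbelianGroup +-abelianGroup using (⁻¹-∙-comm)
  open import Algebra.Properties.Semiring.Mult semiring using (×1-homo-*)
    renaming (_×_ to _×ᵤ_)
  open import Algebra.Properties.Monoid.Mult.TCOptimised +-monoid renaming (_×_ to _·_)
  import Algebra.Solver.Ring as Solver
  open import Algebra.Solver.Ring.AlmostCommutativeRing
    using (fromCommutativeRing; _-Raw-AlmostCommutative⟶_)
  open import Relation.Binary.Reasoning.Setoid setoid

  private
    ⟦_⟧ℤ : ℤ → Carrier
    ⟦ + n ⟧ℤ      = n · 1#
    ⟦ -[1+ n ] ⟧ℤ = - (suc n · 1#)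

    ⊖-homo : ∀ m n → ⟦ m ⊖ n ⟧ℤ ≈ m · 1# - n · 1#
    ⊖-homo m zero = begin
      ⟦ m ⊖ 0 ⟧ℤ     ≡⟨ ≡.cong ⟦_⟧ℤ (ℤ.⊖-≥ {m} ℕ.z≤n) ⟩
      m · 1#         ≈⟨ +-identityʳ _ ⟨
      m · 1# + 0#    ≈⟨ +-congˡ -0#≈0# ⟨
      m · 1# - 0#    ∎
    ⊖-homo zero (suc n) = sym (+-identityˡ _)
    ⊖-homo (suc m) (suc n) = begin
      ⟦ suc m ⊖ suc n ⟧ℤ               ≡⟨ ≡.cong ⟦_⟧ℤ (ℤ.[1+m]⊖[1+n]≡m⊖n m n) ⟩
      ⟦ m ⊖ n ⟧ℤ                       ≈⟨ ⊖-homo m n ⟩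
      x - y                            ≈⟨ +-identityˡ _ ⟨
      0# + (x - y)                     ≈⟨ +-congʳ (-‿inverseʳ 1#) ⟨
      (1# - 1#) + (x - y)              ≈⟨ +-assoc _ _ _ ⟩
      1# + (- 1# + (x - y))            ≈⟨ +-congˡ (+-assoc _ _ _) ⟨
      1# + ((- 1# + x) - y)            ≈⟨ +-congˡ (+-congʳ (+-comm _ _)) ⟩
      1# + ((x - 1#) - y)              ≈⟨ +-congˡ (+-assoc _ _ _) ⟩
      1# + (x + (- 1# - y))            ≈⟨ +-assoc _ _ _ ⟨
      (1# + x) + (- 1# - y)            ≈⟨ +-congˡ (⁻¹-∙-comm 1# y) ⟩
      (1# + x) - (1# + y)              ≈⟨ +-cong (1+× m 1#) (-‿cong (1+× n 1#)) ⟨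
      suc m · 1# - suc n · 1#          ∎
      where x = m · 1# ; y = n · 1#

    neg-homo : ∀ i → ⟦ ℤ.- i ⟧ℤ ≈ - ⟦ i ⟧ℤ
    neg-homo (+ zero)  = sym -0#≈0#
    neg-homo (+ suc n) = refl
    neg-homo -[1+ n ]  = sym (-‿involutive _)

    add-homo : ∀ i j → ⟦ i ℤ.+ j ⟧ℤ ≈ ⟦ i ⟧ℤ + ⟦ j ⟧ℤ
    add-homo (+ m)    (+ n)    = ×-homo-+ 1# m n
    add-homo (+ m)    -[1+ n ] = ⊖-homo m (suc n)
    add-homo -[1+ m ] (+ n)    = trans (⊖-homo n (suc m)) (+-comm _ _)
    add-homo -[1+ m ] -[1+ n ] = begin
      - (suc (suc (m ℕ.+ n)) · 1#)        ≡⟨ ≡.cong (λ k → - (suc k · 1#)) (ℕ-suc m n) ⟩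
      - ((suc m ℕ.+ suc n) · 1#)          ≈⟨ -‿cong (×-homo-+ 1# (suc m) (suc n)) ⟩
      - (suc m · 1# + suc n · 1#)         ≈⟨ ⁻¹-∙-comm _ _ ⟨
      - (suc m · 1#) - (suc n · 1#)       ∎
      where
      open import Data.Nat.Properties using (+-suc)
      ℕ-suc : ∀ m n → suc (m ℕ.+ n) ≡ m ℕ.+ suc n
      ℕ-suc m n = ≡.sym (+-suc m n)

    ×-homo-* : ∀ m n → (m ℕ.* n) · 1# ≈ (m · 1#) * (n · 1#)
    ×-homo-* m n = begin
      (m ℕ.* n) · 1#           ≈⟨ ×ᵤ≈× (m ℕ.* n) 1# ⟨
      (m ℕ.* n) ×ᵤ 1#          ≈⟨ ×1-homo-* m n ⟩
      (m ×ᵤ 1#) * (n ×ᵤ 1#)    ≈⟨ *-cong (×ᵤ≈× m 1#) (×ᵤ≈× n 1#) ⟩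
      (m · 1#) * (n · 1#)      ∎

    +◃-homo : ∀ n → ⟦ Sign.+ ℤ.◃ n ⟧ℤ ≈ n · 1#
    +◃-homo n = reflexive (≡.cong ⟦_⟧ℤ (ℤ.+◃n≡+n n))

    -◃-homo : ∀ n → ⟦ Sign.- ℤ.◃ n ⟧ℤ ≈ - (n · 1#)
    -◃-homo n = trans (reflexive (≡.cong ⟦_⟧ℤ (ℤ.-◃n≡-n n))) (neg-homo (+ n))

    mul-homo : ∀ i j → ⟦ i ℤ.* j ⟧ℤ ≈ ⟦ i ⟧ℤ * ⟦ j ⟧ℤ
    mul-homo (+ m) (+ n) = trans (+◃-homo (m ℕ.* n)) (×-homo-* m n)
    mul-homo (+ m) -[1+ n ] = begin
      _                            ≈⟨ -◃-homo (m ℕ.* suc n) ⟩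
      - ((m ℕ.* suc n) · 1#)       ≈⟨ -‿cong (×-homo-* m (suc n)) ⟩
      - ((m · 1#) * (suc n · 1#))  ≈⟨ -‿distribʳ-* _ _ ⟩
      (m · 1#) * - (suc n · 1#)    ∎
    mul-homo -[1+ m ] (+ n) = begin
      _                            ≈⟨ -◃-homo (suc m ℕ.* n) ⟩
      - ((suc m ℕ.* n) · 1#)       ≈⟨ -‿cong (×-homo-* (suc m) n) ⟩
      - ((suc m · 1#) * (n · 1#))  ≈⟨ -‿distribˡ-* _ _ ⟩
      - (suc m · 1#) * (n · 1#)    ∎
    mul-homo -[1+ m ] -[1+ n ] = begin
      _                                ≈⟨ +◃-homo (suc m ℕ.* suc n) ⟩
      (suc m ℕ.* suc n) · 1#           ≈⟨ ×-homo-* (suc m) (suc n) ⟩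
      (suc m · 1#) * (suc n · 1#)      ≈⟨ -‿involutive _ ⟨
      - - ((suc m · 1#) * (suc n · 1#)) ≈⟨ -‿cong (-‿distribˡ-* _ _) ⟩
      - (- (suc m · 1#) * (suc n · 1#)) ≈⟨ -‿distribʳ-* _ _ ⟩
      - (suc m · 1#) * - (suc n · 1#)  ∎

    almostRing = fromCommutativeRing R

    morphism : ℤ.+-*-rawRing -Raw-AlmostCommutative⟶ almostRing
    morphism = record
      { ⟦_⟧ = ⟦_⟧ℤ ; +-homo = add-homo ; *-homo = mul-homo ; -‿homo = neg-homo
      ; 0-homo = refl ; 1-homo = refl }

    coefficients≟ : WeaklyDecidable (λ i j → ⟦ i ⟧ℤ ≈ ⟦ j ⟧ℤ)
    coefficients≟ i j with i ℤ.≟ j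
    ... | yes i≡j = just (reflexive (≡.cong ⟦_⟧ℤ i≡j))
    ... | no _    = nothing

  open Solver ℤ.+-*-rawRing almostRing morphism coefficients≟ public
    using (solve; _:=_; _:+_; _:*_; _:-_; :-_; con; Polynomial)

  :0 :1 : ∀ {n} → Polynomial n
  :0 = con (+ 0)
  :1 = con (+ 1)

-- The Cauchy product of sequences in a commutative ring

module CauchyProduct {c ℓ} (R : CommutativeRing c ℓ) where

  open CommutativeRing R renaming (zero to *-zero)
  open import Algebra.Definitions.RawSemiring (Semiring.rawSemiring semiring) using (sum; _^_)
  open IntegerSolver R

  _⊛_ : (ℕ → Carrier) → (ℕ → Carrier) → ℕ → Carrier
  (f ⊛ g) n = sum {suc n} (λ k → f (toℕ k) * g (n ∸ toℕ k))

  sum-last : ∀ u n → sum {suc n} (λ k → u (toℕ k)) ≈ sum {n} (λ k → u (toℕ k)) + u n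
  sum-last u zero    = +-comm _ _
  sum-last u (suc n) = trans (+-congˡ (sum-last (λ k → u (suc k)) n)) (sym (+-assoc _ _ _))

  ⊛-cong : ∀ {f f′ g g′} → (∀ n → f n ≈ f′ n) → (∀ n → g n ≈ g′ n) →
           ∀ n → (f ⊛ g) n ≈ (f′ ⊛ g′) n
  ⊛-cong p q zero    = +-congʳ (*-cong (p 0) (q 0))
  ⊛-cong p q (suc n) =
    +-cong (*-cong (p 0) (q (suc n))) (⊛-cong (λ k → p (suc k)) q n)

  -- The recursion that peels off the last term; peeling off the first one,
  -- (f ⊛ g) (suc n) = f 0 * g (suc n) + ((f ∘ suc) ⊛ g) n, is definitional.
  ⊛-last : ∀ f g n → (f ⊛ g) (suc n) ≈ (f ⊛ (λ k → g (suc k))) n + f (suc n) * g 0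
  ⊛-last f g zero = solve 4 (λ a b c d → a :* b :+ (c :* d :+ :0) := (a :* b :+ :0) :+ c :* d)
    refl (f 0) (g 1) (f 1) (g 0)
  ⊛-last f g (suc n) = trans (+-congˡ (⊛-last (λ k → f (suc k)) g n)) (sym (+-assoc _ _ _))

  ⊛-linearˡ : ∀ r u v g n → ((λ k → r * u k + v k) ⊛ g) n ≈ r * (u ⊛ g) n + (v ⊛ g) n
  ⊛-linearˡ r u v g zero =
    solve 4 (λ r u v g → (r :* u :+ v) :* g :+ :0 := r :* (u :* g :+ :0) :+ (v :* g :+ :0))
      refl r (u 0) (v 0) (g 0)
  ⊛-linearˡ r u v g (suc n) =
    trans (+-congˡ (⊛-linearˡ r (λ k → u (suc k)) (λ k → v (suc k)) g n))
      (solve 6 (λ r u v g x y → (r :* u :+ v) :* g :+ (r :* x :+ y)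
                             := r :* (u :* g :+ x) :+ (v :* g :+ y))
        refl r (u 0) (v 0) (g (suc n)) _ _)

  ⊛-linearʳ : ∀ r f u v n → (f ⊛ (λ k → r * u k + v k)) n ≈ r * (f ⊛ u) n + (f ⊛ v) n
  ⊛-linearʳ r f u v zero =
    solve 4 (λ r u v g → g :* (r :* u :+ v) :+ :0 := r :* (g :* u :+ :0) :+ (g :* v :+ :0))
      refl r (u 0) (v 0) (f 0)
  ⊛-linearʳ r f u v (suc n) =
    trans (+-congˡ (⊛-linearʳ r (λ k → f (suc k)) u v n))
      (solve 6 (λ r u v g x y → g :* (r :* u :+ v) :+ (r :* x :+ y)
                             := r :* (g :* u :+ x) :+ (g :* v :+ y))
        refl r (u (suc n)) (v (suc n)) (f 0) _ _)

  ⊛-zeroˡ : ∀ g n → ((λ _ → 0#) ⊛ g) n ≈ 0#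
  ⊛-zeroˡ g zero    = trans (+-identityʳ _) (zeroˡ _)
  ⊛-zeroˡ g (suc n) = trans (+-cong (zeroˡ _) (⊛-zeroˡ g n)) (+-identityʳ _)

  ⊛-constantʳ : ∀ f c n → (f ⊛ (λ _ → c)) n ≈ sum {suc n} (λ k → f (toℕ k)) * c
  ⊛-constantʳ f c zero    = solve 2 (λ x c → x :* c :+ :0 := (x :+ :0) :* c) refl (f 0) c
  ⊛-constantʳ f c (suc n) =
    trans (+-congˡ (⊛-constantʳ (λ k → f (suc k)) c n)) (sym (distribʳ _ _ _))

  -- A sequence starting with 1 is a unit for the Cauchy product, hence cancels.
  ⊛-cancelʳ : ∀ {g} → g 0 ≈ 1# → ∀ u v → (∀ n → (u ⊛ g) n ≈ (v ⊛ g) n) → ∀ n → u n ≈ v n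
  ⊛-cancelʳ {g} g₀≈1 u v eq n = go n u v eq
    where
    first : ∀ u → (u ⊛ g) 0 ≈ u 0
    first u = trans (+-identityʳ _) (trans (*-congˡ g₀≈1) (*-identityʳ _))

    rest : ∀ u n → ((λ k → u (suc k)) ⊛ g) n ≈ (u ⊛ g) (suc n) - u 0 * g (suc n)
    rest u n = solve 2 (λ x y → y := (x :+ y) :- x) refl (u 0 * g (suc n)) _

    go : ∀ n u v → (∀ n → (u ⊛ g) n ≈ (v ⊛ g) n) → u n ≈ v n
    heads : ∀ u v → (∀ n → (u ⊛ g) n ≈ (v ⊛ g) n) → u 0 ≈ v 0
    heads u v eq = trans (sym (first u)) (trans (eq 0) (first v))
    go zero    u v eq = heads u v eq
    go (suc n) u v eq = go n (λ k → u (suc k)) (λ k → v (suc k)) λ j →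
      trans (rest u j) (trans (+-cong (eq (suc j)) (-‿cong (*-congʳ (heads u v eq)))) (sym (rest v j)))

  -- Rescaling the variable commutes with the product.
  ⊛-rescale : ∀ z f g n →
    ((λ k → f k * z ^ k) ⊛ (λ k → g k * z ^ k)) n ≈ (f ⊛ g) n * z ^ n
  ⊛-rescale z f g zero = solve 2 (λ x y → (x :* :1) :* (y :* :1) :+ :0 := (x :* y :+ :0) :* :1)
    refl (f 0) (g 0)
  ⊛-rescale z f g (suc n) = begin
    f 0 * 1# * (g (suc n) * (z * z ^ n)) + ((λ k → f (suc k) * (z * z ^ k)) ⊛ G) n
      ≈⟨ +-congˡ (⊛-cong {g = G} (λ k → solve 3 (λ f z p → f :* (z :* p) := z :* (f :* p) :+ :0)
           refl (f (suc k)) z (z ^ k)) (λ _ → refl) n) ⟩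
    f 0 * 1# * (g (suc n) * (z * z ^ n)) + ((λ k → z * (f (suc k) * z ^ k) + 0#) ⊛ G) n
      ≈⟨ +-congˡ (⊛-linearˡ z (λ k → f (suc k) * z ^ k) (λ _ → 0#) G n) ⟩
    f 0 * 1# * (g (suc n) * (z * z ^ n)) +
      (z * ((λ k → f (suc k) * z ^ k) ⊛ G) n + ((λ _ → 0#) ⊛ G) n)
      ≈⟨ +-congˡ (+-cong (*-congˡ (⊛-rescale z (λ k → f (suc k)) g n)) (⊛-zeroˡ G n)) ⟩
    f 0 * 1# * (g (suc n) * (z * z ^ n)) +
      (z * (((λ k → f (suc k)) ⊛ g) n * z ^ n) + 0#)
      ≈⟨ solve 5 (λ f g z p x → f :* :1 :* (g :* (z :* p)) :+ (z :* (x :* p) :+ :0)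
                             := (f :* g :+ x) :* (z :* p))
           refl (f 0) (g (suc n)) z (z ^ n) _ ⟩
    (f ⊛ g) (suc n) * z ^ suc n ∎
    where
    open import Relation.Binary.Reasoning.Setoid setoid
    G = λ k → g k * z ^ k

-- Ordered fields and their completeness

module OrderedField (ℝ : CompleteOrderedField) where

  open CompleteOrderedField ℝ renaming (zero to *-zero)
  open Eulerian ℝ using (fromℕ)
  open IntegerSolver commutativeRing public
  open IsStrictTotalOrder isStrictTotalOrder public
    using (compare; <-resp-≈; <-respʳ-≈; <-respˡ-≈)
    renaming (trans to <-trans; irrefl to <-irrefl)
  import Relation.Binary.Construct.StrictToNonStrict _≈_ _<_ as ≤
  open import Algebra.Definitions.RawSemiring (Semiring.rawSemiring semiring) using (_^_)

  -- Order

  ≤-trans : ∀ {x y z} → x ≤ y → y ≤ z → x ≤ z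
  ≤-trans = ≤.trans isEquivalence <-resp-≈ <-trans

  <-≤-trans : ∀ {x y z} → x < y → y ≤ z → x < z
  <-≤-trans = ≤.<-≤-trans <-trans <-respʳ-≈

  ≤-<-trans : ∀ {x y z} → x ≤ y → y < z → x < z
  ≤-<-trans = ≤.≤-<-trans sym <-trans <-respˡ-≈

  ≤-refl : ∀ {x} → x ≤ x
  ≤-refl = inj₂ refl

  ≤-respʳ : ∀ {x y z} → y ≈ z → x ≤ y → x ≤ z
  ≤-respʳ e p = ≤-trans p (inj₂ e)

  ≤-respˡ : ∀ {x y z} → x ≈ y → x ≤ z → y ≤ z
  ≤-respˡ e p = ≤-trans (inj₂ (sym e)) p

  <⇒≱ : ∀ {x y} → x < y → ¬ (y ≤ x)
  <⇒≱ p q = <-irrefl refl (<-≤-trans p q)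

  >⇒≉ : ∀ {x y} → y < x → x ≉ y
  >⇒≉ p e = <-irrefl (sym e) p

  ≮⇒≥ : ∀ {x y} → ¬ (x < y) → y ≤ x
  ≮⇒≥ {x} {y} x≮y with compare x y
  ... | tri< x<y _ _ = contradiction x<y x≮y
  ... | tri≈ _ e _   = inj₂ (sym e)
  ... | tri> _ _ y<x = inj₁ y<x

  ≰⇒> : ∀ {x y} → ¬ (x ≤ y) → y < x
  ≰⇒> {x} {y} x≰y with compare x y
  ... | tri< x<y _ _ = contradiction (inj₁ x<y) x≰y
  ... | tri≈ _ e _   = contradiction (inj₂ e) x≰y
  ... | tri> _ _ y<x = y<x

  ≯≮⇒≈ : ∀ {x y} → ¬ (y < x) → ¬ (x < y) → x ≈ y
  ≯≮⇒≈ {x} {y} x≯y x≮y with compare x y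
  ... | tri< x<y _ _ = contradiction x<y x≮y
  ... | tri≈ _ e _   = e
  ... | tri> _ _ y<x = contradiction y<x x≯y

  -- Inequalities are proved by exhibiting the difference as a visibly positive
  -- or nonnegative expression.

  <-by : ∀ {x y t} → 0# < t → y - x ≈ t → x < y
  <-by {x} {y} {t} p e = <-respˡ-≈ (+-identityˡ x) (<-respʳ-≈
    (trans (+-congʳ (sym e)) (solve 2 (λ x y → (y :- x) :+ x := y) refl x y)) (+-monoˡ-< x p))

  ≤-by : ∀ {x y t} → 0# ≤ t → y - x ≈ t → x ≤ y
  ≤-by (inj₁ p) e = inj₁ (<-by p e)
  ≤-by {x} {y} (inj₂ p) e = inj₂ (trans (sym (+-identityʳ x))
    (trans (+-congˡ (trans p (sym e))) (solve 2 (λ x y → x :+ (y :- x) := y) refl x y)))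

  difference-pos : ∀ {x y} → x < y → 0# < y - x
  difference-pos {x} p = <-respˡ-≈ (-‿inverseʳ x) (+-monoˡ-< (- x) p)

  difference-nonneg : ∀ {x y} → x ≤ y → 0# ≤ y - x
  difference-nonneg (inj₁ p) = inj₁ (difference-pos p)
  difference-nonneg {x} (inj₂ p) = inj₂ (trans (sym (-‿inverseʳ x)) (+-congʳ p))

  neg-pos : ∀ {x} → x < 0# → 0# < - x
  neg-pos p = <-respʳ-≈ (+-identityˡ _) (difference-pos p)

  neg-pos⁻¹ : ∀ {x} → 0# < - x → x < 0#
  neg-pos⁻¹ p = <-by p (+-identityˡ _)

  +-nonneg : ∀ {x y} → 0# ≤ x → 0# ≤ y → 0# ≤ x + y
  +-nonneg {x} {y} p q = ≤-trans p (≤-by q (solve 2 (λ x y → (x :+ y) :- x := y) refl x y))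

  +-pos-nonneg : ∀ {x y} → 0# < x → 0# ≤ y → 0# < x + y
  +-pos-nonneg {x} {y} p q = <-≤-trans p (≤-by q (solve 2 (λ x y → (x :+ y) :- x := y) refl x y))

  +-nonneg-pos : ∀ {x y} → 0# ≤ x → 0# < y → 0# < x + y
  +-nonneg-pos p q = <-respʳ-≈ (+-comm _ _) (+-pos-nonneg q p)

  *-nonneg : ∀ {x y} → 0# ≤ x → 0# ≤ y → 0# ≤ x * y
  *-nonneg (inj₁ p) (inj₁ q) = inj₁ (*-pos p q)
  *-nonneg {x} {y} (inj₂ p) _ = inj₂ (trans (sym (zeroˡ y)) (*-congʳ p))
  *-nonneg {x} {y} _ (inj₂ q) = inj₂ (trans (sym (zeroʳ x)) (*-congˡ q))

  +-mono-≤ : ∀ {x y u v} → x ≤ y → u ≤ v → x + u ≤ y + v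
  +-mono-≤ {x} {y} {u} {v} p q = ≤-by (+-nonneg (difference-nonneg p) (difference-nonneg q))
    (solve 4 (λ x y u v → (y :+ v) :- (x :+ u) := (y :- x) :+ (v :- u)) refl x y u v)

  *-monoˡ-≤ : ∀ {x y z} → 0# ≤ z → x ≤ y → z * x ≤ z * y
  *-monoˡ-≤ {x} {y} {z} p q = ≤-by (*-nonneg p (difference-nonneg q))
    (solve 3 (λ x y z → z :* y :- z :* x := z :* (y :- x)) refl x y z)

  square-nonneg : ∀ x → 0# ≤ x * x
  square-nonneg x with compare 0# x
  ... | tri< p _ _ = inj₁ (*-pos p p)
  ... | tri≈ _ p _ = *-nonneg (inj₂ p) (inj₂ p)
  ... | tri> _ _ p = ≤-respʳ (solve 1 (λ x → :- x :* :- x := x :* x) refl x)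
                       (inj₁ (*-pos (neg-pos p) (neg-pos p)))

  0<1 : 0# < 1#
  0<1 = [ (λ p → p) , (λ p → contradiction (sym p) 1≉0) ]′
    (≤-respʳ (*-identityˡ 1#) (square-nonneg 1#))

  -- Squares of nonnegative elements reflect the order.
  square-cancel-≤ : ∀ {x r} → 0# ≤ r → x * x ≤ r * r → x ≤ r
  square-cancel-≤ {x} {r} p q = ≮⇒≥ λ r<x → <⇒≱ (<-by
    (*-pos (difference-pos r<x) (+-pos-nonneg (≤-<-trans p r<x) p))
    (solve 2 (λ x r → x :* x :- r :* r := (x :- r) :* (x :+ r)) refl x r)) q

  -- Inverses

  *-cancelˡ-≈0 : ∀ {x y} → x ≉ 0# → x * y ≈ 0# → y ≈ 0#
  *-cancelˡ-≈0 {x} {y} x≉0 e = trans (sym (*-identityˡ y)) (trans (*-congʳ (sym (⁻¹-inverseʳ x x≉0)))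
    (trans (solve 3 (λ x i y → (x :* i) :* y := i :* (x :* y)) refl x (x ⁻¹) y)
      (trans (*-congˡ e) (zeroʳ _))))

  *-cancelˡ : ∀ {x y z} → x ≉ 0# → x * y ≈ x * z → y ≈ z
  *-cancelˡ {x} {y} {z} x≉0 e = trans (solve 2 (λ y z → y := (y :- z) :+ z) refl y z)
    (trans (+-congʳ (*-cancelˡ-≈0 x≉0 (trans (solve 3 (λ x y z → x :* (y :- z) := x :* y :- x :* z) refl x y z)
      (trans (+-congʳ e) (-‿inverseʳ _))))) (+-identityˡ z))

  *-≉0 : ∀ {x y} → x ≉ 0# → y ≉ 0# → x * y ≉ 0#
  *-≉0 p q e = q (*-cancelˡ-≈0 p e)

  *-cancelˡ-pos : ∀ {x y} → 0# < x → 0# < x * y → 0# < y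
  *-cancelˡ-pos {x} {y} p q with compare 0# y
  ... | tri< r _ _ = r
  ... | tri≈ _ r _ = contradiction (trans (*-congˡ (sym r)) (zeroʳ x)) (>⇒≉ q)
  ... | tri> _ _ r = contradiction
    (<-respʳ-≈ (solve 2 (λ x y → x :* (:- y) := :- (x :* y)) refl x y) (*-pos p (neg-pos r)))
    λ s → <⇒≱ q (inj₁ (neg-pos⁻¹ s))

  *-cancelˡ-nonneg : ∀ {x y} → 0# < x → 0# ≤ x * y → 0# ≤ y
  *-cancelˡ-nonneg p (inj₁ q) = inj₁ (*-cancelˡ-pos p q)
  *-cancelˡ-nonneg p (inj₂ q) = inj₂ (sym (*-cancelˡ-≈0 (>⇒≉ p) (sym q)))

  ⁻¹-pos : ∀ {x} → 0# < x → 0# < x ⁻¹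
  ⁻¹-pos {x} p = *-cancelˡ-pos p (<-respʳ-≈ (sym (⁻¹-inverseʳ x (>⇒≉ p))) 0<1)

  -- Natural numbers

  fromℕ-nonneg : ∀ n → 0# ≤ fromℕ n
  fromℕ-nonneg zero    = ≤-refl
  fromℕ-nonneg (suc n) = +-nonneg (inj₁ 0<1) (fromℕ-nonneg n)

  fromℕ-pos : ∀ n → 0# < fromℕ (suc n)
  fromℕ-pos n = +-pos-nonneg 0<1 (fromℕ-nonneg n)

  fromℕ-≉0 : ∀ n .{{_ : ℕ.NonZero n}} → fromℕ n ≉ 0#
  fromℕ-≉0 (suc n) = >⇒≉ (fromℕ-pos n)

  fromℕ-mono : ∀ {m n} → m ℕ.≤ n → fromℕ m ≤ fromℕ n
  fromℕ-mono {n = n} ℕ.z≤n = fromℕ-nonneg n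
  fromℕ-mono (ℕ.s≤s p) = +-mono-≤ ≤-refl (fromℕ-mono p)

  -- Otherwise the natural numbers have a supremum s, and since n + 1 ≤ s for all n,
  -- also s - 1 is an upper bound.
  archimedean : ExcludedMiddle 0ℓ → ∀ x → ∃[ n ] x < fromℕ n
  archimedean em x with em {∃[ n ] x < fromℕ n}
  ... | yes p = p
  ... | no ¬p = contradiction (s≤ (s - 1#) bound)
                  (<⇒≱ (<-by 0<1 (solve 1 (λ s → s :- (s :- :1) := :1) refl s)))
    where
    P : Carrier → Set
    P y = ∃[ n ] y ≈ fromℕ n

    sup : ∃[ s ] (UpperBound P s × (∀ b → UpperBound P b → s ≤ b))
    sup = supremum P (0# , 0 , refl)
      (x , λ { y (n , e) → ≤-respˡ (sym e) (≮⇒≥ λ q → ¬p (n , q)) })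

    s  = proj₁ sup
    ≤s = proj₁ (proj₂ sup)
    s≤ = proj₂ (proj₂ sup)

    bound : UpperBound P (s - 1#)
    bound y (n , e) = ≤-by (difference-nonneg (≤s (fromℕ (suc n)) (suc n , refl)))
      (trans (+-congˡ (-‿cong e))
        (solve 2 (λ s n → (s :- :1) :- n := s :- (:1 :+ n)) refl s (fromℕ n)))

  -- Powers

  ^-pos : ∀ {q} → 0# < q → ∀ n → 0# < q ^ n
  ^-pos p zero    = 0<1
  ^-pos p (suc n) = *-pos p (^-pos p n)

  -- Bernoulli: (1 - d)ⁿ (1 + n d) ≤ 1 with d = 1 - q.
  bernoulli : ∀ {q} → 0# < q → ∀ n → q ^ n * (1# + fromℕ n * (1# - q)) ≤ 1#
  bernoulli {q} _ zero = inj₂ (solve 1 (λ q → :1 :* (:1 :+ :0 :* (:1 :- q)) := :1) refl q)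
  bernoulli {q} q>0 (suc n) = ≤-trans (≤-by
      (*-nonneg (inj₁ (^-pos q>0 n)) (*-nonneg (inj₁ (fromℕ-pos n)) (square-nonneg (1# - q))))
      (solve 3 (λ q p n → p :* (:1 :+ n :* (:1 :- q)) :- (q :* p) :* (:1 :+ (:1 :+ n) :* (:1 :- q))
                        := p :* ((:1 :+ n) :* ((:1 :- q) :* (:1 :- q))))
        refl q (q ^ n) (fromℕ n)))
    (bernoulli q>0 n)

  -- Every ρ in [0,1) lies below the square of some t in (0,1), namely t = (1 + ρ)/2.
  square-above : ∀ {ρ} → 0# ≤ ρ → ρ < 1# → ∃[ t ] (0# < t × t < 1# × ρ ≤ t * t)
  square-above {ρ} ρ≥0 ρ<1 = h * (1# + ρ) , *-pos h>0 (+-pos-nonneg 0<1 ρ≥0) ,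
    <-by (*-pos h>0 (difference-pos ρ<1))
      (trans (+-congʳ (sym 2h)) (solve 2 (λ h ρ → (h :+ h) :- h :* (:1 :+ ρ) := h :* (:1 :- ρ)) refl h ρ)) ,
    ≤-by (square-nonneg (h * (1# - ρ)))
      (trans (+-congˡ (-‿cong (trans (sym (*-identityˡ ρ)) (trans (*-congʳ (sym (*-identityˡ 1#)))
         (*-congʳ (*-cong (sym 2h) (sym 2h)))))))
       (solve 2 (λ h ρ → (h :* (:1 :+ ρ)) :* (h :* (:1 :+ ρ)) :- (h :+ h) :* (h :+ h) :* ρ
                     := (h :* (:1 :- ρ)) :* (h :* (:1 :- ρ))) refl h ρ))
    where
    2>0 : 0# < 1# + 1#
    2>0 = +-pos-nonneg 0<1 (inj₁ 0<1)
    h = (1# + 1#) ⁻¹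
    h>0 = ⁻¹-pos 2>0
    2h : h + h ≈ 1#
    2h = trans (solve 1 (λ h → h :+ h := (:1 :+ :1) :* h) refl h) (⁻¹-inverseʳ _ (>⇒≉ 2>0))

  -- n qⁿ tends to 0: no multiple of (n + 1) qⁿ stays above 1.  Let q ≤ p² with p < 1,
  -- and d = 1 - p.  Bernoulli gives d (n + 1) pⁿ ≤ 1, so that (n + 1) K qⁿ ≥ 1 implies
  -- d ≤ K pⁿ; multiplied by 1 + n d and bounded by Bernoulli again, this makes n d² ≤ K.
  linear-times-geometric-small : ExcludedMiddle 0ℓ → ∀ {q K} → 0# < q → q < 1# → 0# ≤ K →
    ¬ (∀ n → 1# ≤ fromℕ (suc n) * (K * q ^ n))
  linear-times-geometric-small em {q} {K} q>0 q<1 K≥0 large =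
    <⇒≱ n-large (n-bounded n)
    where
    sqrt-q = square-above (inj₁ q>0) q<1
    p      = proj₁ sqrt-q
    p>0    = proj₁ (proj₂ sqrt-q)
    p<1    = proj₁ (proj₂ (proj₂ sqrt-q))
    q≤p²   = proj₂ (proj₂ (proj₂ sqrt-q))
    d = 1# - p
    d>0 = difference-pos p<1

    q^n≤ : ∀ n → q ^ n ≤ p ^ n * p ^ n
    q^n≤ zero = inj₂ (sym (*-identityˡ 1#))
    q^n≤ (suc n) = ≤-trans (*-monoˡ-≤ (inj₁ q>0) (q^n≤ n))
      (≤-by (*-nonneg (difference-nonneg q≤p²) (*-nonneg (inj₁ (^-pos p>0 n)) (inj₁ (^-pos p>0 n))))
        (solve 3 (λ p q x → (p :* x) :* (p :* x) :- q :* (x :* x) := (p :* p :- q) :* (x :* x)) refl p q (p ^ n)))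

    d≤ : ∀ n → d ≤ K * p ^ n
    d≤ n =
      (≤-by (+-nonneg (*-nonneg (inj₁ d>0) (difference-nonneg (large n)))
              (+-nonneg (*-nonneg (*-nonneg (*-nonneg (inj₁ d>0) (inj₁ (fromℕ-pos n))) K≥0) (difference-nonneg (q^n≤ n)))
                (+-nonneg
                 (*-nonneg (*-nonneg K≥0 x≥0) (difference-nonneg (bernoulli p>0 n)))
                 (*-nonneg (*-nonneg K≥0 x≥0) (*-nonneg x≥0 (inj₁ p>0))))))
        (solve 5 (λ p Q x n K → (K :* x) :- (:1 :- p) :=
             (:1 :- p) :* ((:1 :+ n) :* (K :* Q) :- :1)
             :+ (((:1 :- p) :* (:1 :+ n) :* K) :* (x :* x :- Q)
             :+ ((K :* x) :* (:1 :- x :* (:1 :+ n :* (:1 :- p)))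
             :+ (K :* x) :* (x :* p))))
          refl p (q ^ n) (p ^ n) (fromℕ n) K))
      where x≥0 = inj₁ (^-pos p>0 n)

    n-bounded : ∀ n → fromℕ n * (d * d) ≤ K
    n-bounded n = ≤-by
      (+-nonneg (*-nonneg (difference-nonneg (d≤ n)) (+-nonneg (inj₁ 0<1) (*-nonneg (fromℕ-nonneg n) (inj₁ d>0))))
        (+-nonneg (*-nonneg K≥0 (difference-nonneg (bernoulli p>0 n))) (inj₁ d>0)))
      (solve 4 (λ p x n K → K :- n :* ((:1 :- p) :* (:1 :- p)) :=
          (K :* x :- (:1 :- p)) :* (:1 :+ n :* (:1 :- p))
          :+ (K :* (:1 :- x :* (:1 :+ n :* (:1 :- p))) :+ (:1 :- p)))
        refl p (p ^ n) (fromℕ n) K)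

    large-n = archimedean em (K * (d * d) ⁻¹)
    n = proj₁ large-n
    d² = *-pos d>0 d>0
    n-large : K < fromℕ n * (d * d)
    n-large = <-by (*-pos d² (difference-pos (proj₂ large-n)))
      (trans (+-congˡ (-‿cong (trans (sym (*-identityʳ K)) (*-congˡ (sym (⁻¹-inverseʳ _ (>⇒≉ d²)))))))
        (solve 4 (λ n D K i → n :* D :- K :* (D :* i) := D :* (n :- K :* i)) refl
          (fromℕ n) (d * d) K ((d * d) ⁻¹)))

  -- A geometric sequence becomes arbitrarily small.
  geometric-small : ExcludedMiddle 0ℓ → ∀ {q E ε} → 0# < q → q < 1# → 0# < ε →
    ∃[ N ] (∀ n → N ℕ.≤ n → E * q ^ n < ε)
  geometric-small em {q} {E} {ε} q>0 q<1 ε>0 = N , λ n N≤n → <-by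
      (+-nonneg-pos (*-nonneg (inj₁ ε>0) (difference-nonneg (bernoulli q>0 n)))
        (*-pos (^-pos q>0 n) (+-pos-nonneg ε>0
          (inj₁ (difference-pos (<-≤-trans E< (*-monoˡ-≤ (inj₁ (*-pos ε>0 d>0)) (fromℕ-mono N≤n))))))))
      (solve 5 (λ q x n E ε → ε :- E :* x :=
          ε :* (:1 :- x :* (:1 :+ n :* (:1 :- q))) :+ x :* (ε :+ (ε :* (:1 :- q) :* n :- E)))
        refl q (q ^ n) (fromℕ n) E ε)
    where
    d>0 = difference-pos q<1
    εd = ε * (1# - q)
    εd>0 = *-pos ε>0 d>0
    large-N = archimedean em (E * εd ⁻¹)
    N = proj₁ large-N
    E< : E < εd * fromℕ N
    E< = <-by (*-pos εd>0 (difference-pos (proj₂ large-N)))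
      (trans (+-congˡ (-‿cong (trans (sym (*-identityʳ E)) (*-congˡ (sym (⁻¹-inverseʳ _ (>⇒≉ εd>0)))))))
        (solve 4 (λ n D K i → D :* n :- K :* (D :* i) := D :* (n :- K :* i)) refl
          (fromℕ N) εd E (εd ⁻¹)))

  -- Completeness

  -- A sequence whose tails stay within e n of x n converges, at that rate: the
  -- limit is the supremum of the lower bounds x n - e n.
  cauchy-limit : (x e : ℕ → Carrier) → (∀ n → 0# ≤ e n) →
    (∀ n k → x n ≤ x (k ℕ.+ n) + e n) → (∀ n k → x (k ℕ.+ n) ≤ x n + e n) →
    ∃[ v ] (∀ n → v ≤ x n + e n × x n ≤ v + e n)
  cauchy-limit x e e≥0 lower upper = v , λ n →
    v≤ (x n + e n) (bound n) ,
    ≤-by (difference-nonneg (≤v (x n - e n) (n , refl)))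
      (solve 3 (λ v x e → (v :+ e) :- x := v :- (x :- e)) refl v (x n) (e n))
    where
    P : Carrier → Set
    P y = ∃[ n ] y ≈ x n - e n

    below : ∀ m n → x n - e n ≤ x m + e m
    below m n with ℕ.≤-total n m
    ... | inj₁ n≤m = ≤-by (+-nonneg
            (difference-nonneg (≡.subst (λ k → x n ≤ x k + e n) (ℕ.m∸n+n≡m n≤m) (lower n (m ∸ n)))) (e≥0 m))
            (solve 4 (λ x y e f → (x :+ e) :- (y :- f) := ((x :+ f) :- y) :+ e) refl (x m) (x n) (e m) (e n))
    ... | inj₂ m≤n = ≤-by (+-nonneg
            (difference-nonneg (≡.subst (λ k → x k ≤ x m + e m) (ℕ.m∸n+n≡m m≤n) (upper m (n ∸ m)))) (e≥0 n))
            (solve 4 (λ x y e f → (x :+ e) :- (y :- f) := ((x :+ e) :- y) :+ f) refl (x m) (x n) (e m) (e n))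

    bound : ∀ m → UpperBound P (x m + e m)
    bound m y (n , y≈) = ≤-respˡ (sym y≈) (below m n)

    sup : ∃[ s ] (UpperBound P s × (∀ b → UpperBound P b → s ≤ b))
    sup = supremum P (x 0 - e 0 , 0 , refl) (x 0 + e 0 , bound 0)

    v  = proj₁ sup
    ≤v = proj₁ (proj₂ sup)
    v≤ = proj₂ (proj₂ sup)

-- Polynomials as coefficient sequences

module Polynomials (ℝ : CompleteOrderedField) where

  open CompleteOrderedField ℝ renaming (zero to *-zero)
  open Eulerian ℝ using (coeff; eval)
  open OrderedField ℝ
  open import Relation.Binary.Reasoning.Setoid setoid

  -- Polynomials and formal power series alike are sequences of coefficients.
  Seq : Set
  Seq = ℕ → Carrier

  infix 4 _≋_
  _≋_ : Seq → Seq → Set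
  f ≋ g = ∀ n → f n ≈ g n

  -- f is a polynomial with fewer than N coefficients.
  Short : ℕ → Seq → Set
  Short N f = ∀ n → N ℕ.≤ n → f n ≈ 0#

  -- The constant polynomial.
  const : Carrier → Seq
  const c zero    = c
  const c (suc _) = 0#

  -- (r - X) f
  lin : Carrier → Seq → Seq
  lin r f zero    = r * f 0
  lin r f (suc n) = r * f (suc n) - f n

  -- f ∏ (r - X), over the list.  Unlike X - r, the factor r - X is positive below r.
  lins : List Carrier → Seq → Seq
  lins rs f = foldr lin f rs

  -- The value of the polynomial formed by the first N coefficients.
  ev : ℕ → Seq → Carrier → Carrier
  ev zero    f x = 0#
  ev (suc N) f x = f 0 + x * ev N (f ∘ suc) x

  -- ∏ (r - x)
  Π : List Carrier → Carrier → Carrier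
  Π rs x = foldr (λ r y → (r - x) * y) 1# rs

  const-short : ∀ c → Short 1 (const c)
  const-short c (suc n) _ = refl

  lin-cong : ∀ r {f g} → f ≋ g → lin r f ≋ lin r g
  lin-cong r p zero    = *-congˡ (p 0)
  lin-cong r p (suc n) = +-cong (*-congˡ (p (suc n))) (-‿cong (p n))

  lins-cong : ∀ rs {f g} → f ≋ g → lins rs f ≋ lins rs g
  lins-cong []       p = p
  lins-cong (r ∷ rs) p = lin-cong r (lins-cong rs p)

  lin-short : ∀ {N} r {f} → Short N f → Short (suc N) (lin r f)
  lin-short r {f} p (suc n) (ℕ.s≤s N≤n) = begin
    r * f (suc n) - f n  ≈⟨ +-cong (*-congˡ (p (suc n) (ℕ.m≤n⇒m≤1+n N≤n))) (-‿cong (p n N≤n)) ⟩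
    r * 0# - 0#          ≈⟨ solve 1 (λ r → r :* :0 :- :0 := :0) refl r ⟩
    0#                   ∎

  lins-short : ∀ {N} rs {f} → Short N f → Short (length rs ℕ.+ N) (lins rs f)
  lins-short []       p = p
  lins-short (r ∷ rs) p = lin-short r (lins-short rs p)

  lin-comm : ∀ r s f → lin r (lin s f) ≋ lin s (lin r f)
  lin-comm r s f zero = solve 3 (λ r s x → r :* (s :* x) := s :* (r :* x)) refl r s (f 0)
  lin-comm r s f (suc zero) = solve 4 (λ r s x y →
      r :* (s :* y :- x) :- s :* x := s :* (r :* y :- x) :- r :* x) refl r s (f 0) (f 1)
  lin-comm r s f (suc (suc n)) = solve 5 (λ r s x y z →
      r :* (s :* z :- y) :- (s :* y :- x) := s :* (r :* z :- y) :- (r :* y :- x)) refl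
    r s (f n) (f (suc n)) (f (suc (suc n)))

  lins-comm : ∀ rs s f → lins rs (lin s f) ≋ lin s (lins rs f)
  lins-comm []       s f n = refl
  lins-comm (r ∷ rs) s f n =
    trans (lin-cong r (lins-comm rs s f) n) (lin-comm r s (lins rs f) n)

  lin-scale : ∀ k r f → lin r (λ n → k * f n) ≋ (λ n → k * lin r f n)
  lin-scale k r f zero = solve 3 (λ k r x → r :* (k :* x) := k :* (r :* x)) refl k r (f 0)
  lin-scale k r f (suc n) = solve 4 (λ k r x y → r :* (k :* x) :- k :* y := k :* (r :* x :- y))
    refl k r (f (suc n)) (f n)

  lins-scale : ∀ k rs f → lins rs (λ n → k * f n) ≋ (λ n → k * lins rs f n)
  lins-scale k []       f n = refl
  lins-scale k (r ∷ rs) f n = trans (lin-cong r (lins-scale k rs f) n) (lin-scale k r (lins rs f) n)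

  -- (-1)ᵏ, the leading coefficient of a product of k factors r - X.
  sgn : ℕ → Carrier
  sgn zero    = 1#
  sgn (suc k) = - sgn k

  sgn² : ∀ k → sgn k * sgn k ≈ 1#
  sgn² zero    = *-identityˡ 1#
  sgn² (suc k) = trans (solve 1 (λ s → :- s :* :- s := s :* s) refl (sgn k)) (sgn² k)

  sgn-≉0 : ∀ k → sgn k ≉ 0#
  sgn-≉0 k e = 1≉0 (trans (sym (sgn² k)) (trans (*-congʳ e) (zeroˡ _)))

  lins-leading : ∀ {N} rs {f} → Short (suc N) f →
    lins rs f (length rs ℕ.+ N) ≈ sgn (length rs) * f N
  lins-leading [] p = sym (*-identityˡ _)
  lins-leading {N} (r ∷ rs) {f} p = begin
    r * lins rs f (suc (length rs ℕ.+ N)) - lins rs f (length rs ℕ.+ N)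
      ≈⟨ +-cong (*-congˡ (lins-short rs p (suc (length rs ℕ.+ N)) (ℕ.≤-reflexive (ℕ.+-suc _ N))))
                (-‿cong (lins-leading rs p)) ⟩
    r * 0# - sgn (length rs) * f N
      ≈⟨ solve 3 (λ r s x → r :* :0 :- s :* x := :- s :* x) refl r (sgn (length rs)) (f N) ⟩
    - sgn (length rs) * f N ∎

  -- Evaluation

  ev-cong : ∀ N {f g} → f ≋ g → ∀ x → ev N f x ≈ ev N g x
  ev-cong zero    p x = refl
  ev-cong (suc N) p x = +-cong (p 0) (*-congˡ (ev-cong N (p ∘ suc) x))

  ev-short : ∀ N {f} → Short N f → ∀ x → ev (suc N) f x ≈ ev N f x
  ev-short zero    p x = trans (+-congˡ (zeroʳ x)) (trans (+-identityʳ _) (p 0 ℕ.z≤n))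
  ev-short (suc N) p x = +-congˡ (*-congˡ (ev-short N (λ n N≤n → p (suc n) (ℕ.s≤s N≤n)) x))

  ev-zero : ∀ N {f} → (∀ n → f n ≈ 0#) → ∀ x → ev N f x ≈ 0#
  ev-zero zero    p x = refl
  ev-zero (suc N) p x = trans (+-cong (p 0) (*-congˡ (ev-zero N (p ∘ suc) x)))
    (trans (+-identityˡ _) (zeroʳ x))

  ev-lin+ : ∀ N r f x → ev N (λ n → r * f (suc n) - f n) x ≈ r * ev N (f ∘ suc) x - ev N f x
  ev-lin+ zero r f x = solve 1 (λ r → :0 := r :* :0 :- :0) refl r
  ev-lin+ (suc N) r f x = trans (+-congˡ (*-congˡ (ev-lin+ N r (f ∘ suc) x)))
    (solve 6 (λ r a b x u v → (r :* b :- a) :+ x :* (r :* u :- v)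
                            := r :* (b :+ x :* u) :- (a :+ x :* v))
      refl r (f 0) (f 1) x _ _)

  ev-lin : ∀ N r f → Short N f → ∀ x → ev (suc N) (lin r f) x ≈ (r - x) * ev N f x
  ev-lin N r f p x = begin
    r * f 0 + x * ev N (lin r f ∘ suc) x          ≈⟨ +-congˡ (*-congˡ (ev-lin+ N r f x)) ⟩
    r * f 0 + x * (r * ev N (f ∘ suc) x - ev N f x)
      ≈⟨ solve 5 (λ r a x u v → r :* a :+ x :* (r :* u :- v) := r :* (a :+ x :* u) :- x :* v)
           refl r (f 0) x _ _ ⟩
    r * ev (suc N) f x - x * ev N f x             ≈⟨ +-congʳ (*-congˡ (ev-short N p x)) ⟩
    r * ev N f x - x * ev N f x
      ≈⟨ solve 3 (λ r x v → r :* v :- x :* v := (r :- x) :* v) refl r x _ ⟩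
    (r - x) * ev N f x                            ∎

  ev-lins : ∀ N rs f → Short N f → ∀ x → ev (length rs ℕ.+ N) (lins rs f) x ≈ Π rs x * ev N f x
  ev-lins N []       f p x = sym (*-identityˡ _)
  ev-lins N (r ∷ rs) f p x = trans (ev-lin _ r (lins rs f) (lins-short rs p) x)
    (trans (*-congˡ (ev-lins N rs f p x)) (sym (*-assoc _ _ _)))

  eval≈ev : ∀ {k} (p : Vec Carrier k) x → eval p x ≈ ev k (coeff p) x
  eval≈ev []      x = refl
  eval≈ev (c ∷ p) x = +-congˡ (*-congˡ (eval≈ev p x))

  -- Factoring out roots

  -- Synthetic division: the coefficients of the quotient are, up to sign, the
  -- values at r of the tails of f.
  divide : ∀ N {f} r → Short (suc N) f → ev (suc N) f r ≈ 0# →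
    ∃[ q ] (Short N q × f ≋ lin r q)
  divide N {f} r p root = q , q-short , f≋
    where
    tail : ℕ → Seq
    tail i j = f (j ℕ.+ i)

    q : Seq
    q i = - ev N (tail (suc i)) r

    q-short : Short N q
    q-short n N≤n = trans
      (-‿cong (ev-zero N (λ j → p (j ℕ.+ suc n) (ℕ.≤-trans (ℕ.s≤s N≤n) (ℕ.m≤n+m (suc n) j))) r))
      (solve 0 (:- :0 := :0) refl)

    tail-short : ∀ i → Short N (tail (suc i))
    tail-short i n N≤n = p (n ℕ.+ suc i)
      (≡.subst (suc N ℕ.≤_) (≡.sym (ℕ.+-suc n i)) (ℕ.s≤s (ℕ.≤-trans N≤n (ℕ.m≤m+n n i))))

    shift : ∀ i → (tail i ∘ suc) ≋ tail (suc i)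
    shift i j = reflexive (≡.cong f (≡.sym (ℕ.+-suc j i)))

    f≋ : f ≋ lin r q
    f≋ zero = begin
      f 0              ≈⟨ solve 2 (λ a v → a := (a :+ v) :- v) refl (f 0) (r * ev N (tail 1) r) ⟩
      (f 0 + r * ev N (tail 1) r) - r * ev N (tail 1) r
        ≈⟨ +-congʳ (+-congˡ (*-congˡ (ev-cong N (shift 0) r))) ⟨
      (f 0 + r * ev N (tail 0 ∘ suc) r) - r * ev N (tail 1) r
        ≈⟨ +-congʳ (trans (ev-cong (suc N) (λ j → reflexive (≡.cong f (ℕ.+-identityʳ j))) r) root) ⟩
      0# - r * ev N (tail 1) r
        ≈⟨ solve 2 (λ r v → :0 :- r :* v := r :* (:- v)) refl r _ ⟩
      r * q 0 ∎
    f≋ (suc n) = begin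
      f (suc n) ≈⟨ solve 3 (λ a r v → a := r :* (:- v) :- (:- (a :+ r :* v))) refl (f (suc n)) r _ ⟩
      r * q (suc n) - (- (f (suc n) + r * ev N (tail (suc (suc n))) r))
        ≈⟨ +-congˡ (-‿cong (-‿cong (trans (+-congˡ (*-congˡ (sym (ev-cong N (shift (suc n)) r))))
             (ev-short N (tail-short n) r)))) ⟩
      r * q (suc n) - q n ∎

  -- The list is strictly increasing, with all entries above t.
  Above : Carrier → List Carrier → Set
  Above t []       = ⊤
  Above t (r ∷ rs) = t < r × Above r rs

  above-weaken : ∀ {t u} rs → t < u → Above u rs → Above t rs
  above-weaken []       _ _       = tt
  above-weaken (r ∷ rs) p (q , s) = <-trans p q , s

  above⇒all : ∀ {t} rs → Above t rs → All (t <_) rs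
  above⇒all []       _       = []
  above⇒all (r ∷ rs) (p , q) = p ∷ All.map (<-trans p) (above⇒all rs q)

  -- A polynomial vanishing at distinct points is divisible by ∏ (r - X).
  factor : ∀ N {t f} rs → Above t rs → Short (length rs ℕ.+ N) f →
    All (λ r → ev (length rs ℕ.+ N) f r ≈ 0#) rs → ∃[ q ] (Short N q × f ≋ lins rs q)
  factor N {f = f} [] _ p _ = f , p , λ _ → refl
  factor N {f = f} (r ∷ rs) (_ , above) p (root ∷ roots)
    with q , q-short , f≋ ← divide (length rs ℕ.+ N) r p root
    with g , g-short , q≋ ← factor N rs above q-short
           (All.zipWith (λ {s} → λ { (r<s , e) → *-cancelˡ-≈0
               (λ r-s≈0 → >⇒≉ (difference-pos r<s)
                 (trans (solve 2 (λ r s → s :- r := :- (r :- s)) refl r s)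
                   (trans (-‿cong r-s≈0) (solve 0 (:- :0 := :0) refl))))
               (trans (sym (ev-lin (length rs ℕ.+ N) r q q-short s))
                 (trans (sym (ev-cong (suc (length rs ℕ.+ N)) f≋ s)) e)) })
             (above⇒all rs above , roots))
    = g , g-short , λ n → trans (f≋ n) (lin-cong r q≋ n)

  -- Intermediate values

  value-bound : ∀ N f → ∃[ B ] (0# ≤ B × (∀ {x} → 0# ≤ x → x ≤ 1# → ev N f x ≤ B × - ev N f x ≤ B))
  value-bound zero f = 0# , ≤-refl , λ _ _ → ≤-refl , inj₂ (solve 0 (:- :0 := :0) refl)
  value-bound (suc N) f with B , B≥0 , bound ← value-bound N (f ∘ suc) =
    f 0 * f 0 + 1# + B , +-nonneg (+-nonneg (square-nonneg (f 0)) (inj₁ 0<1)) B≥0 ,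
    λ {x} x≥0 x≤1 → let p , q = bound x≥0 x≤1 in
      ≤-by (+-nonneg (square-bound (f 0))
        (+-nonneg (*-nonneg x≥0 (difference-nonneg p)) (*-nonneg (difference-nonneg x≤1) B≥0)))
        (solve 4 (λ a x v B → (a :* a :+ :1 :+ B) :- (a :+ x :* v) :=
            (a :* a :+ :1 :- a) :+ (x :* (B :- v) :+ (:1 :- x) :* B)) refl (f 0) x _ B) ,
      ≤-by (+-nonneg (square-bound (- f 0))
        (+-nonneg (*-nonneg x≥0 (difference-nonneg q)) (*-nonneg (difference-nonneg x≤1) B≥0)))
        (solve 4 (λ a x v B → (a :* a :+ :1 :+ B) :- (:- (a :+ x :* v)) :=
            ((:- a) :* (:- a) :+ :1 :- (:- a)) :+ (x :* (B :- (:- v)) :+ (:1 :- x) :* B)) refl (f 0) x _ B)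
    where
    square-bound : ∀ a → 0# ≤ a * a + 1# - a
    square-bound a with compare a 0#
    ... | tri< p _ _ = +-nonneg (+-nonneg (square-nonneg a) (inj₁ 0<1)) (inj₁ (neg-pos p))
    ... | tri≈ _ p _ = +-nonneg (+-nonneg (square-nonneg a) (inj₁ 0<1))
                         (inj₂ (trans (solve 0 (:0 := :- :0) refl) (-‿cong (sym p))))
    ... | tri> _ _ p = ≤-respʳ (solve 1 (λ a → (a :- :1) :* (a :- :1) :+ a := a :* a :+ :1 :- a) refl a)
                         (+-nonneg (square-nonneg (a - 1#)) (inj₁ p))

  -- V has Lipschitz constant L on [0,1].
  Lipschitz : Carrier → (Carrier → Carrier) → Set
  Lipschitz L V = ∀ {x y} → 0# ≤ x → x ≤ y → y ≤ 1# →
    (V y - V x ≤ L * (y - x)) × (V x - V y ≤ L * (y - x))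

  ev-lipschitz : ∀ N f → ∃[ L ] (0# ≤ L × Lipschitz L (ev N f))
  ev-lipschitz zero f = 0# , ≤-refl , λ {x} {y} _ _ _ →
    inj₂ (solve 2 (λ x y → :0 :- :0 := :0 :* (y :- x)) refl x y) ,
    inj₂ (solve 2 (λ x y → :0 :- :0 := :0 :* (y :- x)) refl x y)
  ev-lipschitz (suc N) f
    with L , L≥0 , lip ← ev-lipschitz N (f ∘ suc)
    with B , B≥0 , bound ← value-bound N (f ∘ suc) =
    L + B , +-nonneg L≥0 B≥0 , λ {x} {y} x≥0 x≤y y≤1 →
      let p , q   = lip x≥0 x≤y y≤1
          p′ , q′ = bound (≤-trans x≥0 x≤y) y≤1
          d       = difference-nonneg x≤y
          1-x     = difference-nonneg (≤-trans x≤y y≤1)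
      in
      ≤-by (+-nonneg (+-nonneg (*-nonneg d (difference-nonneg p′)) (*-nonneg x≥0 (difference-nonneg p)))
             (*-nonneg (*-nonneg 1-x L≥0) d))
        (solve 7 (λ a x y u v L B → (L :+ B) :* (y :- x) :- ((a :+ y :* v) :- (a :+ x :* u)) :=
            ((y :- x) :* (B :- v) :+ x :* (L :* (y :- x) :- (v :- u))) :+ ((:1 :- x) :* L) :* (y :- x))
          refl (f 0) x y _ _ L B) ,
      ≤-by (+-nonneg (+-nonneg (*-nonneg d (difference-nonneg q′)) (*-nonneg x≥0 (difference-nonneg q)))
             (*-nonneg (*-nonneg 1-x L≥0) d))
        (solve 7 (λ a x y u v L B → (L :+ B) :* (y :- x) :- ((a :+ x :* u) :- (a :+ y :* v)) :=
            ((y :- x) :* (B :- (:- v)) :+ x :* (L :* (y :- x) :- (u :- v))) :+ ((:1 :- x) :* L) :* (y :- x))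
          refl (f 0) x y _ _ L B)

  -- The root is the supremum of the points of [t,u] where V is positive: a nonzero
  -- sign of V at a point persists up to distance ∣V∣ / (L + 1), so V is neither
  -- positive nor negative there.
  intermediate-value : ∀ {L V} → 0# ≤ L → Lipschitz L V → ∀ {t u} → 0# ≤ t → t < u → u ≤ 1# →
    0# < V t → V u < 0# → ∃[ s ] (t < s × s < u × V s ≈ 0#)
  intermediate-value {L} {V} L≥0 lip {t} {u} t≥0 t<u u≤1 Vt>0 Vu<0 = s , t<s , s<u , Vs≈0
    where
    P : Carrier → Set
    P x = t ≤ x × x ≤ u × 0# < V x

    sup : ∃[ s ] (UpperBound P s × (∀ b → UpperBound P b → s ≤ b))
    sup = supremum P (t , ≤-refl , inj₁ t<u , Vt>0) (u , λ x p → proj₁ (proj₂ p))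

    s  = proj₁ sup
    ≤s = proj₁ (proj₂ sup)
    s≤ = proj₂ (proj₂ sup)

    t≤s : t ≤ s
    t≤s = ≤s t (≤-refl , inj₁ t<u , Vt>0)

    s≤u : s ≤ u
    s≤u = s≤ u λ x p → proj₁ (proj₂ p)

    -- L itself may be 0.
    M = L + 1#
    M>0 : 0# < M
    M>0 = +-nonneg-pos L≥0 0<1

    δ : Carrier → Carrier
    δ v = v * M ⁻¹

    δ-pos : ∀ {v} → 0# < v → 0# < δ v
    δ-pos p = *-pos p (⁻¹-pos M>0)

    Mδ : ∀ v → M * δ v ≈ v
    Mδ v = trans (solve 3 (λ M v i → M :* (v :* i) := v :* (M :* i)) refl M v (M ⁻¹))
      (trans (*-congˡ (⁻¹-inverseʳ M (>⇒≉ M>0))) (*-identityʳ v))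

    -- A value v > 0 needs more than the distance δ v to become nonpositive.
    far : ∀ {v w d} → 0# < v → v - w ≤ L * d → w ≤ 0# → δ v < d
    far {v} {w} {d} v>0 p q = ≰⇒> λ d≤δ → <-irrefl refl (<-by
      (+-pos-nonneg (δ-pos v>0) (+-nonneg (*-nonneg L≥0 (difference-nonneg d≤δ))
        (+-nonneg (difference-nonneg p) (difference-nonneg q))))
      (trans (+-congʳ (sym (Mδ v)))
        (solve 5 (λ L D w d v → (L :+ :1) :* D :- v :=
            D :+ (L :* (D :- d) :+ ((L :* d :- (v :- w)) :+ (:0 :- w)))) refl L (δ v) w d v)))

    drop : ∀ {x y} → t ≤ x → x ≤ y → y ≤ u → V x - V y ≤ L * (y - x)
    drop t≤x x≤y y≤u = proj₂ (lip (≤-trans t≥0 t≤x) x≤y (≤-trans y≤u u≤1))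

    neg-drop : ∀ {x y} → t ≤ x → x ≤ y → y ≤ u → - V y - - V x ≤ L * (y - x)
    neg-drop {x} {y} t≤x x≤y y≤u = ≤-respˡ (solve 2 (λ a b → a :- b := :- b :- :- a) refl (V x) (V y))
      (drop t≤x x≤y y≤u)

    neg-≤0 : ∀ {x} → 0# ≤ x → - x ≤ 0#
    neg-≤0 {x} p = ≤-by p (solve 1 (λ x → :0 :- :- x := x) refl x)

    ¬Vs>0 : ¬ (0# < V s)
    ¬Vs>0 Vs>0 = <⇒≱ s<x (≤s x (≤-trans t≤s (inj₁ s<x) , x≤u , Vx>0))
      where
      x = s + δ (V s)

      s<x : s < x
      s<x = <-by (δ-pos Vs>0) (solve 2 (λ s d → (s :+ d) :- s := d) refl s (δ (V s)))

      x≤u : x ≤ u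
      x≤u = inj₁ (<-by (difference-pos (far Vs>0 (drop t≤s s≤u ≤-refl) (inj₁ Vu<0)))
        (solve 3 (λ u s d → u :- (s :+ d) := (u :- s) :- d) refl u s (δ (V s))))

      Vx>0 : 0# < V x
      Vx>0 = ≰⇒> λ Vx≤0 → <-irrefl (solve 2 (λ s d → d := (s :+ d) :- s) refl s (δ (V s)))
        (far Vs>0 (drop t≤s (inj₁ s<x) x≤u) Vx≤0)

    ¬Vs<0 : ¬ (V s < 0#)
    ¬Vs<0 Vs<0 = <⇒≱ (<-by (δ-pos (neg-pos Vs<0)) (solve 2 (λ s d → s :- (s :- d) := d) refl s _))
      (s≤ (s - δ (- V s)) λ { x (t≤x , x≤u , Vx>0) → inj₁
        (<-by (difference-pos (far (neg-pos Vs<0)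
            (neg-drop t≤x (≤s x (t≤x , x≤u , Vx>0)) s≤u) (neg-≤0 (inj₁ Vx>0))))
          (solve 3 (λ x s d → (s :- d) :- x := (s :- x) :- d) refl x s _)) })

    Vs≈0 : V s ≈ 0#
    Vs≈0 = ≯≮⇒≈ ¬Vs>0 ¬Vs<0

    t<s : t < s
    t<s = <-by (<-trans (δ-pos Vt>0) (far Vt>0 (drop ≤-refl t≤s s≤u) (inj₂ Vs≈0))) refl

    s<u : s < u
    s<u = <-by (<-trans (δ-pos (neg-pos Vu<0))
      (far (neg-pos Vu<0) (neg-drop t≤s s≤u ≤-refl) (neg-≤0 (inj₂ (sym Vs≈0))))) refl

  -- V is negative at the first point, positive at the second one, and so on.
  Alternating : (Carrier → Carrier) → List Carrier → Set
  Alternating V []       = ⊤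
  Alternating V (u ∷ us) = V u < 0# × Alternating (λ x → - V x) us

  alternating-scale : ∀ {V W} us → All (λ x → ∃[ k ] (0# < k × W x ≈ k * V x)) us →
    Alternating V us → Alternating W us
  alternating-scale [] _ _ = tt
  alternating-scale {V} {W} (u ∷ us) ((k , k>0 , e) ∷ ks) (p , ps) =
    neg-pos⁻¹ (<-respʳ-≈ (trans (solve 2 (λ k v → k :* (:- v) := :- (k :* v)) refl k (V u)) (-‿cong (sym e)))
      (*-pos k>0 (neg-pos p))) ,
    alternating-scale us (All.map (λ { {x} (k , k>0 , e) → k , k>0 ,
      trans (-‿cong e) (solve 2 (λ k v → :- (k :* v) := k :* (:- v)) refl k (V x)) }) ks) ps

  lipschitz-neg : ∀ {L V} → Lipschitz L V → Lipschitz L (λ x → - V x)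
  lipschitz-neg {L} {V} lip {x} {y} x≥0 x≤y y≤1 with p , q ← lip x≥0 x≤y y≤1 =
    ≤-respˡ (solve 2 (λ a b → a :- b := :- b :- :- a) refl (V x) (V y)) q ,
    ≤-respˡ (solve 2 (λ a b → b :- a := :- a :- :- b) refl (V x) (V y)) p

  -- If V is positive at t and alternates along the points us above t, then it has a
  -- root between any two neighbours among t and us.
  alternating-roots : ∀ {L V} → 0# ≤ L → Lipschitz L V → ∀ {t} → 0# ≤ t → 0# < V t →
    ∀ us → Above t us → All (_≤ 1#) us → Alternating V us →
    ∃[ ss ] (length ss ≡ length us × Above t ss × All (_< 1#) ss × All (λ s → V s ≈ 0#) ss)
  alternating-roots _ _ _ _ [] _ _ _ = [] , ≡.refl , tt , [] , []
  alternating-roots {L} {V} L≥0 lip {t} t≥0 Vt>0 (u ∷ us) (t<u , above) (u≤1 ∷ us≤1) (Vu<0 , alt) =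
    let s , t<s , s<u , Vs≈0 = intermediate-value L≥0 lip t≥0 t<u u≤1 Vt>0 Vu<0
        ss , len , above′ , ss<1 , roots = alternating-roots L≥0 (lipschitz-neg lip)
          (≤-trans t≥0 (inj₁ t<u)) (neg-pos Vu<0) us above us≤1 alt
    in s ∷ ss , ≡.cong suc len , (t<s , above-weaken ss s<u above′) , <-≤-trans s<u u≤1 ∷ ss<1 ,
      Vs≈0 ∷ All.map (λ {x} e → trans (solve 1 (λ v → v := :- :- v) refl (V x))
                         (trans (-‿cong e) (solve 0 (:- :0 := :0) refl))) roots

-- The recursion for Eulerian polynomials and its effect on zeros

module EulerianOperator (ℝ : CompleteOrderedField) where

  open CompleteOrderedField ℝ renaming (zero to *-zero)
  open Eulerian ℝ using (fromℕ)
  open OrderedField ℝ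
  open Polynomials ℝ
  open import Relation.Binary.Reasoning.Setoid setoid

  -- The operator p ↦ (1 - X)(α p + X p′) + s X p.  It satisfies
  -- (α + X d/dX) (p (1 - X)^(-s)) = (step s α p) (1 - X)^(-(s+1)).
  step : Carrier → Carrier → Seq → Seq
  step s α p zero    = α * p 0
  step s α p (suc n) = (α + fromℕ (suc n)) * p (suc n) + (s - α - fromℕ n) * p n

  -- X f
  X*_ : Seq → Seq
  (X* f) zero    = 0#
  (X* f) (suc n) = f n

  ev-sub : ∀ N f g x → ev N (λ n → f n - g n) x ≈ ev N f x - ev N g x
  ev-sub zero    f g x = solve 0 (:0 := :0 :- :0) refl
  ev-sub (suc N) f g x = trans (+-congˡ (*-congˡ (ev-sub N (f ∘ suc) (g ∘ suc) x)))
    (solve 5 (λ a b x u v → (a :- b) :+ x :* (u :- v) := (a :+ x :* u) :- (b :+ x :* v))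
      refl (f 0) (g 0) x _ _)

  module _ (s α : Carrier) where

    step-cong : ∀ {f g} → f ≋ g → step s α f ≋ step s α g
    step-cong p zero    = *-congˡ (p 0)
    step-cong p (suc n) = +-cong (*-congˡ (p (suc n))) (*-congˡ (p n))

    step-short : ∀ {N f} → Short N f → Short (suc N) (step s α f)
    step-short {f = f} p (suc n) (ℕ.s≤s N≤n) =
      trans (+-cong (*-congˡ (p (suc n) (ℕ.m≤n⇒m≤1+n N≤n))) (*-congˡ (p n N≤n)))
        (trans (+-cong (zeroʳ _) (zeroʳ _)) (+-identityˡ 0#))

    -- The Leibniz rule: the extra term is -X (1 - X) q, as (r - X)′ = -1.
    step-lin : ∀ r q → step s α (lin r q) ≋ (λ n → lin r (step s α q) n - (X* lin 1# q) n)
    step-lin r q zero = solve 3 (λ α r x → α :* (r :* x) := r :* (α :* x) :- :0) refl α r (q 0)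
    step-lin r q (suc zero) = solve 5 (λ s α r x y →
        (α :+ (:1 :+ :0)) :* (r :* y :- x) :+ (s :- α :- :0) :* (r :* x) :=
        (r :* ((α :+ (:1 :+ :0)) :* y :+ (s :- α :- :0) :* x) :- α :* x) :- :1 :* x)
      refl s α r (q 0) (q 1)
    step-lin r q (suc (suc n)) = solve 7 (λ s α r n x y z →
        (α :+ (:1 :+ (:1 :+ n))) :* (r :* z :- y) :+ (s :- α :- (:1 :+ n)) :* (r :* y :- x) :=
        (r :* ((α :+ (:1 :+ (:1 :+ n))) :* z :+ (s :- α :- (:1 :+ n)) :* y)
          :- ((α :+ (:1 :+ n)) :* y :+ (s :- α :- n) :* x)) :- (:1 :* y :- x))
      refl s α r (fromℕ n) (q n) (q (suc n)) (q (suc (suc n)))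

    module _ (c : Carrier) where

      -- The value of step s α (c ∏ (r - X)) at x.
      val : List Carrier → Carrier → Carrier
      val []       x = c * (α * (1# - x) + s * x)
      val (r ∷ rs) x = (r - x) * val rs x - x * ((1# - x) * (c * Π rs x))

      ev-val : ∀ rs x → ev (suc (length rs ℕ.+ 1)) (step s α (lins rs (const c))) x ≈ val rs x
      ev-val [] x = solve 4 (λ s α c x →
          α :* c :+ x :* (((α :+ (:1 :+ :0)) :* :0 :+ (s :- α :- :0) :* c) :+ x :* :0)
          := c :* (α :* (:1 :- x) :+ s :* x)) refl s α c x
      ev-val (r ∷ rs) x = begin
        ev (suc (suc N)) (step s α (lin r q)) x
          ≈⟨ ev-cong (suc (suc N)) (step-lin r q) x ⟩
        ev (suc (suc N)) (λ n → lin r (step s α q) n - (X* lin 1# q) n) x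
          ≈⟨ ev-sub (suc (suc N)) (lin r (step s α q)) (X* lin 1# q) x ⟩
        ev (suc (suc N)) (lin r (step s α q)) x - (0# + x * ev (suc N) (lin 1# q) x)
          ≈⟨ +-cong (ev-lin (suc N) r (step s α q) (step-short q-short) x)
               (-‿cong (trans (+-identityˡ _) (*-congˡ (ev-lin N 1# q q-short x)))) ⟩
        (r - x) * ev (suc N) (step s α q) x - x * ((1# - x) * ev N q x)
          ≈⟨ +-cong (*-congˡ (ev-val rs x)) (-‿cong (*-congˡ (*-congˡ value))) ⟩
        val (r ∷ rs) x ∎
        where
        q = lins rs (const c)
        N = length rs ℕ.+ 1
        q-short : Short N q
        q-short = lins-short rs (const-short c)
        value : ev N q x ≈ c * Π rs x
        value = trans (ev-lins 1 rs (const c) (const-short c) x)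
          (solve 3 (λ p c x → p :* (c :+ x :* :0) := c :* p) refl (Π rs x) c x)

      val-at-0 : ∀ rs → val rs 0# ≈ α * (c * Π rs 0#)
      val-at-0 [] = solve 3 (λ s α c → c :* (α :* (:1 :- :0) :+ s :* :0) := α :* (c :* :1)) refl s α c
      val-at-0 (r ∷ rs) = trans (+-congʳ (*-congˡ (val-at-0 rs)))
        (solve 4 (λ α c r p → (r :- :0) :* (α :* (c :* p)) :- :0 :* ((:1 :- :0) :* (c :* p))
                            := α :* (c :* ((r :- :0) :* p))) refl α c r (Π rs 0#))

      val-at-1 : ∀ rs → val rs 1# ≈ s * (c * Π rs 1#)
      val-at-1 [] = solve 3 (λ s α c → c :* (α :* (:1 :- :1) :+ s :* :1) := s :* (c :* :1)) refl s α c
      val-at-1 (r ∷ rs) = trans (+-congʳ (*-congˡ (val-at-1 rs)))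
        (solve 4 (λ s c r p → (r :- :1) :* (s :* (c :* p)) :- :1 :* ((:1 :- :1) :* (c :* p))
                            := s :* (c :* ((r :- :1) :* p))) refl s c r (Π rs 1#))

  Π-pos : ∀ {t} rs → Above t rs → 0# < Π rs t
  Π-pos []       _       = 0<1
  Π-pos {t} (r ∷ rs) (p , q) = *-pos (difference-pos p) (Π-pos rs (above-weaken rs p q))

  Π-roots : ∀ rs → All (λ x → Π rs x ≈ 0#) rs
  Π-roots []       = []
  Π-roots (r ∷ rs) = trans (*-congʳ (-‿inverseʳ r)) (zeroˡ _) ∷
    All.map (λ e → trans (*-congˡ e) (zeroʳ _)) (Π-roots rs)

  -- Past its roots, the sign of ∏ (r - X) is that of its leading coefficient.
  Π-sign : ∀ {t} rs → All (_< t) rs → ∃[ y ] (0# < y × Π rs t ≈ sgn (length rs) * y)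
  Π-sign [] [] = 1# , 0<1 , sym (*-identityˡ 1#)
  Π-sign {t} (r ∷ rs) (p ∷ ps) = let y , y>0 , e = Π-sign rs ps in
    (t - r) * y , *-pos (difference-pos p) y>0 ,
    trans (*-congˡ e) (solve 4 (λ r t s y → (r :- t) :* (s :* y) := :- s :* ((t :- r) :* y))
      refl r t (sgn (length rs)) y)

  -- At the roots r₁ < r₂ < … of p = c ∏ (r - X) in (0,1), the value of step s α p is
  -- r (1 - r) p′(r), so its signs alternate.  Points es, all equal to 1, may be
  -- appended if the signs alternate along them for constant p.
  val-alternates : ∀ s α {c} → 0# < c → ∀ es → All (_≈ 1#) es → Alternating (val s α c []) es →
    ∀ {t} rs → 0# ≤ t → Above t rs → All (_< 1#) rs → Alternating (val s α c rs) (rs ++ es)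
  val-alternates s α c>0 es es≈1 alt [] _ _ _ = alt
  val-alternates s α {c} c>0 es es≈1 alt {t} (r ∷ rs) t≥0 (t<r , above) (r<1 ∷ rs<1) =
    neg-pos⁻¹ (<-respʳ-≈
      (solve 4 (λ r v c p → r :* ((:1 :- r) :* (c :* p)) := :- ((r :- r) :* v :- r :* ((:1 :- r) :* (c :* p))))
        refl r (val s α c rs r) c (Π rs r))
      (*-pos r>0 (*-pos (difference-pos r<1) (*-pos c>0 (Π-pos rs above))))) ,
    alternating-scale (rs ++ es) (++⁺
        (All.zipWith (λ { (r<x , e) → scale r<x (trans (*-congˡ e) (zeroʳ _)) }) (above⇒all rs above , Π-roots rs))
        (All.map (λ e → scale (<-respʳ-≈ (sym e) r<1)
            (trans (*-congʳ (trans (+-congˡ (-‿cong e)) (-‿inverseʳ 1#))) (zeroˡ _))) es≈1))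
      (val-alternates s α c>0 es es≈1 alt rs (inj₁ r>0) above rs<1)
    where
    r>0 = ≤-<-trans t≥0 t<r

    scale : ∀ {x} → r < x → (1# - x) * Π rs x ≈ 0# →
      ∃[ k ] (0# < k × - val s α c (r ∷ rs) x ≈ k * val s α c rs x)
    scale {x} r<x e = x - r , difference-pos r<x , (begin
      - ((r - x) * val s α c rs x - x * ((1# - x) * (c * Π rs x)))
        ≈⟨ solve 5 (λ r x v c p → :- ((r :- x) :* v :- x :* ((:1 :- x) :* (c :* p)))
                                := (x :- r) :* v :+ (x :* c) :* ((:1 :- x) :* p))
             refl r x (val s α c rs x) c (Π rs x) ⟩
      (x - r) * val s α c rs x + x * c * ((1# - x) * Π rs x)
        ≈⟨ trans (+-congˡ (trans (*-congˡ e) (zeroʳ _))) (+-identityʳ _) ⟩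
      (x - r) * val s α c rs x ∎)

  above-++ : ∀ {t u} rs → t < u → Above t rs → All (_< u) rs → Above t (rs ++ u ∷ [])
  above-++ []       p _       _          = p , tt
  above-++ (r ∷ rs) _ (p , q) (r<u ∷ ps) = p , above-++ rs r<u q ps

  -- One step from p = c ∏ (r - X), where c > 0 and the zeros r are distinct and lie
  -- in (0,1).
  module _ (s α : Carrier) (α>0 : 0# < α) {c} (c>0 : 0# < c)
           {rs} (above : Above 0# rs) (rs<1 : All (_< 1#) rs) where

    private
      p = lins rs (const c)

      p′-short : Short (suc (length rs ℕ.+ 1)) (step s α p)
      p′-short = step-short s α (lins-short rs (const-short c))

      val>0 : 0# < val s α c rs 0#
      val>0 = <-respʳ-≈ (sym (val-at-0 s α c rs)) (*-pos α>0 (*-pos c>0 (Π-pos rs above)))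

      -- The zeros of step s α p interlacing with 0, the zeros of p and the points es,
      -- and the quotient by the corresponding linear factors.
      interlace : ∀ es → All (_≈ 1#) es → Alternating (val s α c []) es → Above 0# (rs ++ es) →
        ∀ N → suc (length rs ℕ.+ 1) ≡ length (rs ++ es) ℕ.+ N →
        ∃[ ss ] (length ss ≡ length (rs ++ es) × Above 0# ss × All (_< 1#) ss ×
          ∃[ q ] (Short N q × step s α p ≋ lins ss q))
      interlace es es≈1 alt above′ N eq =
        let M = suc (length rs ℕ.+ 1)
            L , L≥0 , lip = ev-lipschitz M (step s α p)
            ss , len , above-ss , ss<1 , roots = alternating-roots L≥0
              (λ {x} {y} x≥0 x≤y y≤1 → let u , v = lip x≥0 x≤y y≤1 in
                ≤-respˡ (+-cong (ev-val s α c rs y) (-‿cong (ev-val s α c rs x))) u ,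
                ≤-respˡ (+-cong (ev-val s α c rs x) (-‿cong (ev-val s α c rs y))) v)
              ≤-refl val>0 (rs ++ es) above′
              (++⁺ (All.map inj₁ rs<1) (All.map inj₂ es≈1))
              (val-alternates s α c>0 es es≈1 alt rs ≤-refl above rs<1)
            M≡ = ≡.trans eq (≡.cong (ℕ._+ N) (≡.sym len))
            q , q-short , e = factor N ss above-ss
              (≡.subst (λ k → Short k (step s α p)) M≡ p′-short)
              (All.map (λ {r} root → trans
                (reflexive (≡.cong (λ k → ev k (step s α p) r) (≡.sym M≡)))
                (trans (ev-val s α c rs r) root)) roots)
        in ss , len , above-ss , ss<1 , q , q-short , e

    abstract
      -- For s < 0 the values of p and step s α p at 1 have opposite signs, which gives
      -- one more zero in (0,1).
      step-negative : s < 0# → ∃[ c′ ] ∃[ ss ] (0# < c′ × Above 0# ss × All (_< 1#) ss ×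
        length ss ≡ suc (length rs) × step s α p ≋ lins ss (const c′))
      step-negative s<0 =
        let snoc : length (rs ++ 1# ∷ []) ≡ suc (length rs)
            snoc = ≡.trans (List.length-++ rs) (ℕ.+-comm (length rs) 1)
            ss , len , above-ss , ss<1 , q , q-short , e = interlace (1# ∷ []) (refl ∷ [])
              (neg-pos⁻¹ (<-respʳ-≈ (solve 3 (λ s α c → c :* (:- s) := :- (c :* (α :* (:1 :- :1) :+ s :* :1))) refl s α c)
                 (*-pos c>0 (neg-pos s<0))) , tt)
              (above-++ rs 0<1 above rs<1) 1
              (≡.sym (≡.cong (ℕ._+ 1) snoc))
            q≋ : q ≋ const (q 0)
            q≋ = λ { zero → refl ; (suc n) → q-short (suc n) (ℕ.s≤s ℕ.z≤n) }
            M≡ : suc (length rs ℕ.+ 1) ≡ length ss ℕ.+ 1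
            M≡ = ≡.cong (ℕ._+ 1) (≡.sym (≡.trans len snoc))
            value : Π ss 0# * q 0 ≈ val s α c rs 0#
            value = trans (*-congˡ (solve 1 (λ x → x := x :+ :0 :* :0) refl (q 0)))
              (trans (sym (ev-lins 1 ss q q-short 0#))
              (trans (sym (ev-cong (length ss ℕ.+ 1) e 0#))
              (trans (reflexive (≡.cong (λ k → ev k (step s α p) 0#) (≡.sym M≡))) (ev-val s α c rs 0#))))
        in q 0 , ss , *-cancelˡ-pos (Π-pos ss above-ss) (<-respʳ-≈ (sym value) val>0) , above-ss , ss<1 ,
           ≡.trans len snoc ,
           λ n → trans (e n) (lins-cong ss q≋ n)

      -- For s ≥ 0 the remaining factor q₀ + q₁ X has q₁ < 0, from the leading
      -- coefficient, and q₀ + q₁ ≥ 0, from the value at 1.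
      step-nonnegative : 0# ≤ s → s - α - fromℕ (length rs) < 0# →
        ∃[ c′ ] ∃[ z₀ ] ∃[ ss ] (0# < c′ × 1# ≤ z₀ × Above 0# ss × All (_< 1#) ss ×
          step s α p ≋ lins ss (lin z₀ (const c′)))
      step-nonnegative s≥0 lead =
        let ss , len′ , above-ss , ss<1 , q , q-short , e = interlace [] [] tt
              (≡.subst (Above 0#) (≡.sym (List.++-identityʳ rs)) above) 2
              (≡.sym (≡.trans (≡.cong (λ l → length l ℕ.+ 2) (List.++-identityʳ rs)) (ℕ.+-suc (length rs) 1)))
            len : length ss ≡ length rs
            len = ≡.trans len′ (≡.cong length (List.++-identityʳ rs))
            k = length rs
            y , y>0 , Πss≈ = Π-sign ss ss<1
            w , w>0 , Πrs≈ = Π-sign rs rs<1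
            q₁≈ : q 1 ≈ (s - α - fromℕ k) * c
            q₁≈ = *-cancelˡ (sgn-≉0 k) (begin
              sgn k * q 1
                ≈⟨ *-congʳ (reflexive (≡.cong sgn (≡.sym len))) ⟩
              sgn (length ss) * q 1
                ≈⟨ lins-leading ss q-short ⟨
              lins ss q (length ss ℕ.+ 1)
                ≈⟨ e (length ss ℕ.+ 1) ⟨
              step s α p (length ss ℕ.+ 1)
                ≈⟨ reflexive (≡.cong (step s α p) (≡.trans (≡.cong (ℕ._+ 1) len) (ℕ.+-comm k 1))) ⟩
              (α + fromℕ (suc k)) * p (suc k) + (s - α - fromℕ k) * p k
                ≈⟨ +-cong (*-congˡ (lins-short rs (const-short c) (suc k) (ℕ.≤-reflexive (ℕ.+-comm k 1))))
                     (*-congˡ (trans (reflexive (≡.cong p (≡.sym (ℕ.+-identityʳ k)))) (lins-leading rs (const-short c)))) ⟩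
              (α + fromℕ (suc k)) * 0# + (s - α - fromℕ k) * (sgn k * c)
                ≈⟨ solve 4 (λ a x g c → a :* :0 :+ x :* (g :* c) := g :* (x :* c)) refl
                     (α + fromℕ (suc k)) (s - α - fromℕ k) (sgn k) c ⟩
              sgn k * ((s - α - fromℕ k) * c) ∎)
            q₁>0 : 0# < - q 1
            q₁>0 = <-respʳ-≈ (trans (solve 2 (λ x c → (:- x) :* c := :- (x :* c)) refl _ c) (-‿cong (sym q₁≈)))
              (*-pos (neg-pos lead) c>0)
            at-1 : y * (q 0 + q 1) ≈ s * (c * w)
            at-1 = *-cancelˡ (sgn-≉0 k) (begin
              sgn k * (y * (q 0 + q 1))
                ≈⟨ solve 4 (λ g y a b → g :* (y :* (a :+ b)) := (g :* y) :* (a :+ :1 :* (b :+ :1 :* :0)))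
                     refl (sgn k) y (q 0) (q 1) ⟩
              sgn k * y * ev 2 q 1#
                ≈⟨ *-congʳ (trans (*-congʳ (reflexive (≡.cong sgn (≡.sym len)))) (sym Πss≈)) ⟩
              Π ss 1# * ev 2 q 1#
                ≈⟨ ev-lins 2 ss q q-short 1# ⟨
              ev (length ss ℕ.+ 2) (lins ss q) 1#
                ≈⟨ ev-cong (length ss ℕ.+ 2) e 1# ⟨
              ev (length ss ℕ.+ 2) (step s α p) 1#
                ≈⟨ reflexive (≡.cong (λ j → ev j (step s α p) 1#) (≡.trans (≡.cong (ℕ._+ 2) len) (ℕ.+-suc k 1))) ⟩
              ev (suc (k ℕ.+ 1)) (step s α p) 1#
                ≈⟨ ev-val s α c rs 1# ⟩
              val s α c rs 1#
                ≈⟨ val-at-1 s α c rs ⟩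
              s * (c * Π rs 1#)
                ≈⟨ *-congˡ (*-congˡ Πrs≈) ⟩
              s * (c * (sgn k * w))
                ≈⟨ solve 4 (λ s c g w → s :* (c :* (g :* w)) := g :* (s :* (c :* w))) refl s c (sgn k) w ⟩
              sgn k * (s * (c * w)) ∎)
            q₀+q₁≥0 : 0# ≤ q 0 + q 1
            q₀+q₁≥0 = *-cancelˡ-nonneg y>0 (≤-respʳ (sym at-1) (*-nonneg s≥0 (inj₁ (*-pos c>0 w>0))))
            i = (- q 1) ⁻¹
            q₁i : - q 1 * i ≈ 1#
            q₁i = ⁻¹-inverseʳ _ (>⇒≉ q₁>0)
            z₀ = q 0 * i
            q≋ : q ≋ lin z₀ (const (- q 1))
            q≋ = λ { zero → trans (sym (*-identityʳ (q 0))) (trans (*-congˡ (sym q₁i))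
                       (solve 3 (λ a b i → a :* (b :* i) := (a :* i) :* b) refl (q 0) (- q 1) i))
                   ; (suc zero) → solve 2 (λ b z → b := z :* :0 :- (:- b)) refl (q 1) z₀
                   ; (suc (suc n)) → trans (q-short (suc (suc n)) (ℕ.s≤s (ℕ.s≤s ℕ.z≤n)))
                       (solve 1 (λ z → :0 := z :* :0 :- :0) refl z₀) }
        in - q 1 , z₀ , ss , q₁>0 ,
           ≤-by (*-nonneg q₀+q₁≥0 (inj₁ (⁻¹-pos q₁>0)))
             (trans (+-congˡ (-‿cong (sym q₁i)))
               (solve 3 (λ a b i → a :* i :- (:- b) :* i := (a :+ b) :* i) refl (q 0) (q 1) i)) ,
           above-ss , ss<1 , λ n → trans (e n) (lins-cong ss q≋ n)

-- Binomial series and the hypergeometric series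

module BinomialSeries (ℝ : CompleteOrderedField) where

  open CompleteOrderedField ℝ renaming (zero to *-zero)
  open Eulerian ℝ using (fromℕ; pochhammer; binomialSeries)
  open OrderedField ℝ
  open CauchyProduct commutativeRing
  open Polynomials ℝ
  open EulerianOperator ℝ
  open import Algebra.Properties.Semiring.Mult semiring using (×1-homo-*)
  open import Relation.Binary.Reasoning.Setoid setoid

  private
    b = binomialSeries

  pochhammer-cong : ∀ {s t} → s ≈ t → ∀ n → pochhammer s n ≈ pochhammer t n
  pochhammer-cong e zero    = refl
  pochhammer-cong e (suc n) = *-cong (pochhammer-cong e n) (+-congʳ e)

  binomialSeries-cong : ∀ {s t} → s ≈ t → b s ≋ b t
  binomialSeries-cong e n = *-congʳ (pochhammer-cong e n)

  factorial-inverse : ∀ n → fromℕ (n !) * fromℕ (n !) ⁻¹ ≈ 1#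
  factorial-inverse n = ⁻¹-inverseʳ _ (fromℕ-≉0 (n !) {{n ℕ.!≢0}})

  binomialSeries-0 : ∀ s → b s 0 ≈ 1#
  binomialSeries-0 s = trans (*-congʳ (sym (+-identityʳ 1#))) (factorial-inverse 0)

  binomialSeries-suc : ∀ s n → fromℕ (suc n) * b s (suc n) ≈ (s + fromℕ n) * b s n
  binomialSeries-suc s n = *-cancelˡ (fromℕ-≉0 (n !) {{n ℕ.!≢0}}) (begin
    m! * (k * (p * x * i))    ≈⟨ solve 5 (λ m k p x i → m :* (k :* (p :* x :* i)) := (p :* x) :* ((k :* m) :* i)) refl m! k p x i ⟩
    p * x * (k * m! * i)      ≈⟨ *-congˡ (trans (*-congʳ (sym (×1-homo-* (suc n) (n !)))) (factorial-inverse (suc n))) ⟩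
    p * x * 1#                ≈⟨ *-congˡ (factorial-inverse n) ⟨
    p * x * (m! * j)          ≈⟨ solve 4 (λ p x m j → (p :* x) :* (m :* j) := m :* (x :* (p :* j))) refl p x m! j ⟩
    m! * (x * (p * j))        ∎)
    where
    m! = fromℕ (n !)
    k  = fromℕ (suc n)
    p  = pochhammer s n
    x  = s + fromℕ n
    i  = fromℕ (suc n !) ⁻¹
    j  = fromℕ (n !) ⁻¹

  -- s (1 - X)^(-(s+1)) is the derivative of (1 - X)^(-s).
  binomialSeries-derivative : ∀ s n → s * b (s + 1#) n ≈ fromℕ (suc n) * b s (suc n)
  binomialSeries-derivative s zero = begin
    s * b (s + 1#) 0           ≈⟨ *-congˡ (binomialSeries-0 (s + 1#)) ⟩
    s * 1#                     ≈⟨ solve 1 (λ s → s :* :1 := (s :+ :0) :* :1) refl s ⟩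
    (s + 0#) * 1#              ≈⟨ *-congˡ (binomialSeries-0 s) ⟨
    (s + 0#) * b s 0           ≈⟨ binomialSeries-suc s 0 ⟨
    fromℕ 1 * b s 1            ∎
  binomialSeries-derivative s (suc n) = *-cancelˡ (fromℕ-≉0 (suc n)) (begin
    k * (s * b (s + 1#) (suc n))              ≈⟨ solve 3 (λ k s x → k :* (s :* x) := s :* (k :* x)) refl k s _ ⟩
    s * (k * b (s + 1#) (suc n))              ≈⟨ *-congˡ (binomialSeries-suc (s + 1#) n) ⟩
    s * ((s + 1# + fromℕ n) * b (s + 1#) n)   ≈⟨ solve 3 (λ s n x → s :* ((s :+ :1 :+ n) :* x) := (s :+ (:1 :+ n)) :* (s :* x)) refl s (fromℕ n) _ ⟩
    (s + k) * (s * b (s + 1#) n)              ≈⟨ *-congˡ (binomialSeries-derivative s n) ⟩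
    (s + k) * (k * b s (suc n))               ≈⟨ solve 3 (λ x k y → x :* (k :* y) := k :* (x :* y)) refl (s + k) k _ ⟩
    k * ((s + k) * b s (suc n))               ≈⟨ *-congˡ (binomialSeries-suc s (suc n)) ⟨
    k * (fromℕ (suc (suc n)) * b s (suc (suc n))) ∎)
    where k = fromℕ (suc n)

  -- (1 - X) (1 - X)^(-(s+1)) = (1 - X)^(-s)
  binomialSeries-telescope : ∀ s n → b (s + 1#) (suc n) ≈ b (s + 1#) n + b s (suc n)
  binomialSeries-telescope s n = *-cancelˡ (fromℕ-≉0 (suc n)) (begin
    k * b (s + 1#) (suc n)              ≈⟨ binomialSeries-suc (s + 1#) n ⟩
    (s + 1# + fromℕ n) * x              ≈⟨ solve 3 (λ s n x → (s :+ :1 :+ n) :* x := (:1 :+ n) :* x :+ s :* x) refl s (fromℕ n) x ⟩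
    k * x + s * x                       ≈⟨ +-congˡ (binomialSeries-derivative s n) ⟩
    k * x + k * b s (suc n)             ≈⟨ distribˡ _ _ _ ⟨
    k * (x + b s (suc n))               ∎)
    where
    k = fromℕ (suc n)
    x = b (s + 1#) n

  const-⊛ : ∀ c g n → (const c ⊛ g) n ≈ c * g n
  const-⊛ c g zero    = +-identityʳ _
  const-⊛ c g (suc n) = trans (+-congˡ (⊛-zeroˡ g n)) (+-identityʳ _)

  -- (α + X d/dX) (p (1 - X)^(-s)) = (step s α p) (1 - X)^(-(s+1)), by induction along the
  -- coefficients of p, using (α + X d/dX) (X f) = X (α + 1 + X d/dX) f.
  step-⊛ : ∀ s α p n → (step s α p ⊛ b (s + 1#)) n ≈ (α + fromℕ n) * (p ⊛ b s) n
  step-⊛ s α p zero = begin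
    α * p 0 * b (s + 1#) 0 + 0#        ≈⟨ +-congʳ (*-congˡ (trans (binomialSeries-0 (s + 1#)) (sym (binomialSeries-0 s)))) ⟩
    α * p 0 * b s 0 + 0#               ≈⟨ solve 3 (λ α p x → α :* p :* x :+ :0 := (α :+ :0) :* (p :* x :+ :0)) refl α (p 0) (b s 0) ⟩
    (α + 0#) * (p 0 * b s 0 + 0#)      ∎
  step-⊛ s α p (suc n) = begin
    α * p 0 * b (s + 1#) (suc n) + ((step s α p ∘ suc) ⊛ b (s + 1#)) n
      ≈⟨ +-cong (*-congˡ (binomialSeries-telescope s n)) (⊛-cong {g = b (s + 1#)} tail (λ _ → refl) n) ⟩
    α * p 0 * (x + y) + ((λ k → (s - α) * const (p 0) k + step s (α + 1#) (p ∘ suc) k) ⊛ b (s + 1#)) n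
      ≈⟨ +-congˡ (trans (⊛-linearˡ (s - α) (const (p 0)) (step s (α + 1#) (p ∘ suc)) (b (s + 1#)) n)
           (+-cong (*-congˡ (const-⊛ (p 0) (b (s + 1#)) n)) (step-⊛ s (α + 1#) (p ∘ suc) n))) ⟩
    α * p 0 * (x + y) + ((s - α) * (p 0 * x) + (α + 1# + fromℕ n) * w)
      ≈⟨ solve 7 (λ s α p x y n w → α :* p :* (x :+ y) :+ ((s :- α) :* (p :* x) :+ (α :+ :1 :+ n) :* w)
           := p :* (α :* y :+ s :* x) :+ (α :+ (:1 :+ n)) :* w) refl s α (p 0) x y (fromℕ n) w ⟩
    p 0 * (α * y + s * x) + (α + k) * w
      ≈⟨ +-congʳ (*-congˡ (+-congˡ (binomialSeries-derivative s n))) ⟩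
    p 0 * (α * y + k * y) + (α + k) * w
      ≈⟨ solve 5 (λ p α y k w → p :* (α :* y :+ k :* y) :+ (α :+ k) :* w := (α :+ k) :* (p :* y :+ w))
           refl (p 0) α y k w ⟩
    (α + k) * (p 0 * y + w) ∎
    where
    x = b (s + 1#) n
    y = b s (suc n)
    k = fromℕ (suc n)
    w = ((p ∘ suc) ⊛ b s) n

    tail : (step s α p ∘ suc) ≋ (λ k → (s - α) * const (p 0) k + step s (α + 1#) (p ∘ suc) k)
    tail zero = solve 4 (λ s α x y → (α :+ (:1 :+ :0)) :* y :+ (s :- α :- :0) :* x
                                   := (s :- α) :* x :+ (α :+ :1) :* y) refl s α (p 0) (p 1)
    tail (suc n) = solve 5 (λ s α n x y → (α :+ (:1 :+ (:1 :+ n))) :* y :+ (s :- α :- (:1 :+ n)) :* x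
        := (s :- α) :* :0 :+ ((α :+ :1 :+ (:1 :+ n)) :* y :+ (s :- (α :+ :1) :- n) :* x))
      refl s α (fromℕ n) (p (suc n)) (p (suc (suc n)))

  -- The polynomial obtained from the constant γ by the operators step (k + a) αⱼ for
  -- k = 0, …, m - 1.  The last one to be applied belongs to α₀.
  eulerian : Carrier → Carrier → ∀ m → (Fin m → Carrier) → Seq
  eulerian a γ zero    α = const γ
  eulerian a γ (suc m) α = step (fromℕ m + a) (α Fin.zero) (eulerian a γ m (α ∘ Fin.suc))

  -- ∏ (x + αⱼ)
  shifts : ∀ m → (Fin m → Carrier) → Carrier → Carrier
  shifts zero    α x = 1#
  shifts (suc m) α x = (α Fin.zero + x) * shifts m (α ∘ Fin.suc) x

  eulerian-⊛ : ∀ a γ m α n →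
    (eulerian a γ m α ⊛ b (fromℕ m + a)) n ≈ shifts m α (fromℕ n) * γ * b a n
  eulerian-⊛ a γ zero α zero = trans (+-identityʳ _)
    (trans (*-congˡ (binomialSeries-cong (+-identityˡ a) 0)) (*-congʳ (sym (*-identityˡ γ))))
  eulerian-⊛ a γ zero α (suc n) = trans (+-congˡ (⊛-zeroˡ (b (0# + a)) n)) (trans (+-identityʳ _)
    (trans (*-congˡ (binomialSeries-cong (+-identityˡ a) (suc n))) (*-congʳ (sym (*-identityˡ γ)))))
  eulerian-⊛ a γ (suc m) α n = begin
    (p ⊛ b (fromℕ (suc m) + a)) n
      ≈⟨ ⊛-cong {f = p} (λ _ → refl) (binomialSeries-cong
           (solve 2 (λ m a → (:1 :+ m) :+ a := (m :+ a) :+ :1) refl (fromℕ m) a)) n ⟩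
    (p ⊛ b (fromℕ m + a + 1#)) n
      ≈⟨ step-⊛ (fromℕ m + a) (α Fin.zero) (eulerian a γ m (α ∘ Fin.suc)) n ⟩
    (α Fin.zero + fromℕ n) * (eulerian a γ m (α ∘ Fin.suc) ⊛ b (fromℕ m + a)) n
      ≈⟨ *-congˡ (eulerian-⊛ a γ m (α ∘ Fin.suc) n) ⟩
    (α Fin.zero + fromℕ n) * (shifts m (α ∘ Fin.suc) (fromℕ n) * γ * b a n)
      ≈⟨ solve 4 (λ x y g b → x :* (y :* g :* b) := (x :* y) :* g :* b) refl _ _ γ (b a n) ⟩
    shifts (suc m) α (fromℕ n) * γ * b a n ∎
    where p = eulerian a γ (suc m) α

  lin-⊛ : ∀ r f g → (lin r f ⊛ g) ≋ lin r (f ⊛ g)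
  lin-⊛ r f g zero = solve 3 (λ r x y → r :* x :* y :+ :0 := r :* (x :* y :+ :0)) refl r (f 0) (g 0)
  lin-⊛ r f g (suc n) = begin
    r * f 0 * g (suc n) + ((lin r f ∘ suc) ⊛ g) n
      ≈⟨ +-congˡ (⊛-cong {g = g} (λ k → solve 3 (λ r x y → r :* x :- y := r :* x :+ (:- :1 :* y :+ :0)) refl r (f (suc k)) (f k)) (λ _ → refl) n) ⟩
    r * f 0 * g (suc n) + ((λ k → r * f (suc k) + (- 1# * f k + 0#)) ⊛ g) n
      ≈⟨ +-congˡ (trans (⊛-linearˡ r (f ∘ suc) (λ k → - 1# * f k + 0#) g n)
           (+-congˡ (trans (⊛-linearˡ (- 1#) f (λ _ → 0#) g n) (+-congˡ (⊛-zeroˡ g n))))) ⟩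
    r * f 0 * g (suc n) + (r * ((f ∘ suc) ⊛ g) n + (- 1# * (f ⊛ g) n + 0#))
      ≈⟨ solve 5 (λ r x y u v → r :* x :* y :+ (r :* u :+ (:- :1 :* v :+ :0)) := r :* (x :* y :+ u) :- v)
           refl r (f 0) (g (suc n)) _ _ ⟩
    lin r (f ⊛ g) (suc n) ∎

  lins-⊛ : ∀ rs f g → (lins rs f ⊛ g) ≋ lins rs (f ⊛ g)
  lins-⊛ []       f g n = refl
  lins-⊛ (r ∷ rs) f g n = trans (lin-⊛ r (lins rs f) g n) (lin-cong r (lins-⊛ rs f g) n)

  -- (1 - X)^(-s) (1 - X)^s = 1: the coefficients c of the product satisfy
  -- (n + 1) cₙ₊₁ = n cₙ.
  binomialSeries-inverse : ∀ s n → (b s ⊛ b (- s)) (suc n) ≈ 0#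
  binomialSeries-inverse s = vanish
    where
    c : Seq
    c = b s ⊛ b (- s)

    -- (α + D) (f g) = ((α + D) f) g + f (D g) for the derivation D = X d/dX.
    derivation : ∀ α f g n → (α + fromℕ n) * (f ⊛ g) n ≈
      ((λ k → (α + fromℕ k) * f k) ⊛ g) n + (f ⊛ (λ k → fromℕ k * g k)) n
    derivation α f g zero = solve 3 (λ α x y → (α :+ :0) :* (x :* y :+ :0) :=
      ((α :+ :0) :* x :* y :+ :0) :+ (x :* (:0 :* y) :+ :0)) refl α (f 0) (g 0)
    derivation α f g (suc n) = begin
      (α + fromℕ (suc n)) * (f 0 * g (suc n) + w)
        ≈⟨ solve 5 (λ α n x y w → (α :+ (:1 :+ n)) :* (x :* y :+ w) :=
             (α :+ :0) :* x :* y :+ x :* ((:1 :+ n) :* y) :+ (α :+ :1 :+ n) :* w)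
             refl α (fromℕ n) (f 0) (g (suc n)) w ⟩
      u + v + (α + 1# + fromℕ n) * w
        ≈⟨ +-congˡ (derivation (α + 1#) (f ∘ suc) g n) ⟩
      u + v + (((λ k → (α + 1# + fromℕ k) * f (suc k)) ⊛ g) n + z)
        ≈⟨ +-congˡ (+-congʳ (⊛-cong {g = g} (λ k → *-congʳ {x = f (suc k)} (+-assoc α 1# (fromℕ k))) (λ _ → refl) n)) ⟩
      u + v + (((λ k → (α + fromℕ (suc k)) * f (suc k)) ⊛ g) n + z)
        ≈⟨ solve 4 (λ u v x z → (u :+ v) :+ (x :+ z) := (u :+ x) :+ (v :+ z)) refl u v _ z ⟩
      _ ∎
      where
      w = ((f ∘ suc) ⊛ g) n
      u = (α + 0#) * f 0 * g (suc n)
      v = f 0 * (fromℕ (suc n) * g (suc n))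
      z = ((f ∘ suc) ⊛ (λ k → fromℕ k * g k)) n

    recurrence : ∀ n → fromℕ (suc n) * c (suc n) ≈ fromℕ n * c n
    recurrence n = begin
      fromℕ (suc n) * c (suc n)
        ≈⟨ *-congʳ (+-identityˡ _) ⟨
      (0# + fromℕ (suc n)) * c (suc n)
        ≈⟨ derivation 0# (b s) (b (- s)) (suc n) ⟩
      ((λ k → (0# + fromℕ k) * b s k) ⊛ b (- s)) (suc n) + (b s ⊛ (λ k → fromℕ k * b (- s) k)) (suc n)
        ≈⟨ +-cong
             (+-congˡ (⊛-cong {g = b (- s)} (λ k → trans (*-congʳ (+-identityˡ _)) (binomialSeries-suc s k)) (λ _ → refl) n))
             (trans (⊛-last (b s) (λ k → fromℕ k * b (- s) k) n)
               (+-congʳ (trans (⊛-cong {f = b s} (λ _ → refl) (λ k → trans (binomialSeries-suc (- s) k) (distribʳ _ _ _)) n)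
                 (⊛-linearʳ (- s) (b s) (b (- s)) (λ k → fromℕ k * b (- s) k) n)))) ⟩
      ((0# + 0#) * b s 0 * b (- s) (suc n) + x) + ((- s * c n + y) + b s (suc n) * (0# * b (- s) 0))
        ≈⟨ solve 8 (λ u v x y w z s c → ((:0 :+ :0) :* u :* v :+ x) :+ ((:- s :* c :+ y) :+ w :* (:0 :* z))
                              := (x :+ y) :- s :* c) refl (b s 0) (b (- s) (suc n)) x y (b s (suc n)) (b (- s) 0) s (c n) ⟩
      (x + y) - s * c n
        ≈⟨ +-congʳ (derivation s (b s) (b (- s)) n) ⟨
      (s + fromℕ n) * c n - s * c n
        ≈⟨ solve 3 (λ s n c → (s :+ n) :* c :- s :* c := n :* c) refl s (fromℕ n) (c n) ⟩
      fromℕ n * c n ∎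
      where
      x = ((λ k → (s + fromℕ k) * b s k) ⊛ b (- s)) n
      y = (b s ⊛ (λ k → fromℕ k * b (- s) k)) n

    vanish : ∀ n → c (suc n) ≈ 0#
    vanish zero    = *-cancelˡ-≈0 (fromℕ-≉0 1) (trans (recurrence 0) (zeroˡ _))
    vanish (suc n) = *-cancelˡ-≈0 (fromℕ-≉0 (suc (suc n)))
      (trans (recurrence (suc n)) (trans (*-congˡ (vanish n)) (zeroʳ _)))

-- Power series over complete normed rings

-- A commutative ring with a complete submultiplicative norm, given by the relation
-- Bound z r, which stands for ∣z∣ ≤ r.  ‖ z ‖ is some bound for z.  The factor 2 in
-- the rate of convergence lets completeness be proved componentwise.
record NormedRing (ℝ : CompleteOrderedField) : Set₁ where

  open CompleteOrderedField ℝ using (Carrier; _≤_; 0#; 1#; _+_; _*_)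

  field
    commutativeRing : CommutativeRing 0ℓ 0ℓ

  open CommutativeRing commutativeRing public using ()
    renaming (Carrier to A; _≈_ to _≈ᴬ_; _+_ to _+ᴬ_; _*_ to _*ᴬ_; -_ to -ᴬ_; _-_ to _-ᴬ_; 0# to 0ᴬ; 1# to 1ᴬ)

  field
    Bound        : A → Carrier → Set
    bound-nonneg : ∀ {z r} → Bound z r → 0# ≤ r
    bound-cong   : ∀ {z w r} → z ≈ᴬ w → Bound z r → Bound w r
    bound-mono   : ∀ {z r s} → r ≤ s → Bound z r → Bound z s
    bound-+      : ∀ {z w r s} → Bound z r → Bound w s → Bound (z +ᴬ w) (r + s)
    bound-*      : ∀ {z w r s} → Bound z r → Bound w s → Bound (z *ᴬ w) (r * s)
    bound-neg    : ∀ {z r} → Bound z r → Bound (-ᴬ z) r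
    bound-0      : Bound 0ᴬ 0#
    bound-1      : ∀ {r} → Bound 1ᴬ r → 1# ≤ r
    ‖_‖          : A → Carrier
    bound-exists : ∀ z → Bound z ‖ z ‖
    complete     : ∀ (x : ℕ → A) (e : ℕ → Carrier) → (∀ n → 0# ≤ e n) →
                   (∀ n k → Bound (x (k ℕ.+ n) -ᴬ x n) (e n)) →
                   ∃[ v ] (∀ n → Bound (x n -ᴬ v) (e n + e n))

module NormedSeries (em : ExcludedMiddle 0ℓ) (ℝ : CompleteOrderedField) (N : NormedRing ℝ) where

  open CompleteOrderedField ℝ renaming (zero to *-zero)
  open Eulerian ℝ using (fromℕ)
  open OrderedField ℝ
  open NormedRing N renaming (commutativeRing to ringᴬ)
  open CommutativeRing ringᴬ using ()
    renaming (refl to reflᴬ; sym to symᴬ; trans to transᴬ; +-cong to +ᴬ-cong; *-cong to *ᴬ-cong;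
              -‿cong to -ᴬ-cong; setoid to setoidᴬ; semiring to semiringᴬ)
  open IntegerSolver ringᴬ using ()
    renaming (solve to solveᴬ; _:=_ to _⊜_; _:+_ to _⊕_; _:*_ to _⊗_; _:-_ to _⊝_; :-_ to ⊝_; :0 to :0ᴬ; :1 to :1ᴬ)
  open import Algebra.Definitions.RawSemiring (Semiring.rawSemiring semiring) using (_^_)
  open import Algebra.Definitions.RawSemiring (Semiring.rawSemiring semiringᴬ) using ()
    renaming (sum to sumᴬ; _^_ to _^ᴬ_)
  open import Relation.Binary.Reasoning.Setoid setoidᴬ
  private
    module A⊛ = CauchyProduct ringᴬ
  open A⊛ using (_⊛_)

  -- The sum of the first n terms.
  S : (ℕ → A) → ℕ → A
  S u n = sumᴬ {n} (λ k → u (toℕ k))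

  -- The partial sums of u tend to v at least as fast as qⁿ tends to 0.
  Converges : Carrier → (ℕ → A) → A → Set
  Converges q u v = ∃[ E ] (∀ n → Bound (S u n -ᴬ v) (E * q ^ n))

  module _ {q} (q>0 : 0# < q) (q<1 : q < 1#) where

    private
      1-q>0 = difference-pos q<1
      d = (1# - q) ⁻¹
      d>0 = ⁻¹-pos 1-q>0
      q^≥0 : ∀ n → 0# ≤ q ^ n
      q^≥0 n = inj₁ (^-pos q>0 n)

    geometric-limit : ∀ (u : ℕ → A) C → 0# ≤ C → (∀ n → Bound (u n) (C * q ^ n)) → ∃[ v ] Converges q u v
    geometric-limit u C C≥0 u-bound =
      let v , lim = complete (S u) e e≥0 tail
      in v , C * d + C * d , λ n → bound-mono (inj₂ (sym (distribʳ (q ^ n) (C * d) (C * d)))) (lim n)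
      where
      e : ℕ → Carrier
      e n = C * d * q ^ n

      e≥0 : ∀ n → 0# ≤ e n
      e≥0 n = *-nonneg (*-nonneg C≥0 (inj₁ d>0)) (q^≥0 n)

      -- C (qⁿ + … + qⁿ⁺ᵏ⁻¹) = C d (qⁿ - qⁿ⁺ᵏ)
      tail-sharp : ∀ n k → Bound (S u (k ℕ.+ n) -ᴬ S u n) (e n - e (k ℕ.+ n))
      tail-sharp n zero = bound-cong (symᴬ (solveᴬ 1 (λ s → s ⊝ s ⊜ :0ᴬ) reflᴬ (S u n)))
        (bound-mono (inj₂ (sym (-‿inverseʳ (e n)))) bound-0)
      tail-sharp n (suc k) = bound-cong
        (begin
          (S u m -ᴬ S u n) +ᴬ u m   ≈⟨ solveᴬ 3 (λ a b c → (a ⊝ b) ⊕ c ⊜ (a ⊕ c) ⊝ b) reflᴬ (S u m) (S u n) (u m) ⟩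
          (S u m +ᴬ u m) -ᴬ S u n   ≈⟨ +ᴬ-cong (symᴬ (A⊛.sum-last u m)) reflᴬ ⟩
          S u (suc m) -ᴬ S u n      ∎)
        (bound-mono (inj₂ (trans (+-congˡ (trans (sym (*-identityʳ _)) (*-congˡ (sym (⁻¹-inverseʳ _ (>⇒≉ 1-q>0))))))
            (solve 5 (λ C D q x y → (C :* D :* x :- C :* D :* y) :+ (C :* y) :* ((:1 :- q) :* D)
                := C :* D :* x :- C :* D :* (q :* y)) refl C d q (q ^ n) (q ^ m))))
          (bound-+ (tail-sharp n k) (u-bound m)))
        where m = k ℕ.+ n

      tail : ∀ n k → Bound (S u (k ℕ.+ n) -ᴬ S u n) (e n)
      tail n k = bound-mono (≤-by (e≥0 (k ℕ.+ n))
        (solve 2 (λ x y → x :- (x :- y) := y) refl (e n) (e (k ℕ.+ n)))) (tail-sharp n k)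

    -- Terms that eventually shrink by the factor q are dominated by C qⁿ.
    ratio-test : ∀ N (u : ℕ → A) → (∀ n → N ℕ.≤ n → ∀ {r} → Bound (u n) r → Bound (u (suc n)) (q * r)) →
      ∃[ C ] (0# ≤ C × (∀ n → Bound (u n) (C * q ^ n)))
    ratio-test zero u shrink = C , bound-nonneg (bound-exists (u 0)) , dominated
      where
      C = ‖ u 0 ‖
      dominated : ∀ n → Bound (u n) (C * q ^ n)
      dominated zero    = bound-mono (inj₂ (sym (*-identityʳ C))) (bound-exists (u 0))
      dominated (suc n) = bound-mono (inj₂ (solve 3 (λ q C x → q :* (C :* x) := C :* (q :* x)) refl q C (q ^ n)))
        (shrink n ℕ.z≤n (dominated n))
    ratio-test (suc N) u shrink =
      let C , C≥0 , dominated = ratio-test N (u ∘ suc) (λ n p → shrink (suc n) (ℕ.s≤s p))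
          C₀ = ‖ u 0 ‖
          C₀≥0 = bound-nonneg (bound-exists (u 0))
          i≥0 = inj₁ (⁻¹-pos q>0)
      in C₀ + C * q ⁻¹ , +-nonneg C₀≥0 (*-nonneg C≥0 i≥0) , λ
        { zero → bound-mono (≤-by (*-nonneg C≥0 i≥0)
            (solve 2 (λ a b → (a :+ b) :* :1 :- a := b) refl C₀ (C * q ⁻¹))) (bound-exists (u 0))
        ; (suc n) → bound-mono (≤-by (*-nonneg C₀≥0 (q^≥0 (suc n)))
            (trans (+-congˡ (-‿cong (trans (sym (*-identityʳ _)) (*-congˡ (sym (⁻¹-inverseʳ q (>⇒≉ q>0)))))))
              (solve 5 (λ a C q i x → (a :+ C :* i) :* (q :* x) :- (C :* x) :* (q :* i) := a :* (q :* x))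
                refl C₀ C q (q ⁻¹) (q ^ n)))) (dominated n) }

    converges-scale : ∀ {f g : ℕ → A} {z v} c → (∀ n → g n ≈ᴬ c *ᴬ f n) →
      Converges q (λ n → f n *ᴬ z ^ᴬ n) v → Converges q (λ n → g n *ᴬ z ^ᴬ n) (c *ᴬ v)
    converges-scale {f} {g} {z} {v} c g≈ (E , bound) = ‖ c ‖ * E , λ n →
      bound-cong (symᴬ (difference n))
        (bound-mono (inj₂ (sym (*-assoc _ _ _))) (bound-* (bound-exists c) (bound n)))
      where
      s = S (λ n → f n *ᴬ z ^ᴬ n)
      t = S (λ n → g n *ᴬ z ^ᴬ n)

      partial : ∀ n → t n ≈ᴬ c *ᴬ s n
      partial zero = solveᴬ 1 (λ c → :0ᴬ ⊜ c ⊗ :0ᴬ) reflᴬ c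
      partial (suc n) = begin
        t (suc n)                                ≈⟨ A⊛.sum-last (λ n → g n *ᴬ z ^ᴬ n) n ⟩
        t n +ᴬ g n *ᴬ z ^ᴬ n                     ≈⟨ +ᴬ-cong (partial n) (*ᴬ-cong (g≈ n) reflᴬ) ⟩
        c *ᴬ s n +ᴬ (c *ᴬ f n) *ᴬ z ^ᴬ n
          ≈⟨ solveᴬ 4 (λ c s f p → c ⊗ s ⊕ (c ⊗ f) ⊗ p ⊜ c ⊗ (s ⊕ f ⊗ p)) reflᴬ c (s n) (f n) (z ^ᴬ n) ⟩
        c *ᴬ (s n +ᴬ f n *ᴬ z ^ᴬ n)              ≈⟨ *ᴬ-cong reflᴬ (symᴬ (A⊛.sum-last (λ n → f n *ᴬ z ^ᴬ n) n)) ⟩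
        c *ᴬ s (suc n)                           ∎

      difference : ∀ n → t n -ᴬ c *ᴬ v ≈ᴬ c *ᴬ (s n -ᴬ v)
      difference n = transᴬ (+ᴬ-cong (partial n) reflᴬ)
        (solveᴬ 3 (λ c s v → c ⊗ s ⊝ c ⊗ v ⊜ c ⊗ (s ⊝ v)) reflᴬ c (s n) v)

    -- The series of (X - w) f sums to (z - w) v.
    converges-linear : ∀ {f g : ℕ → A} {z v} w → g 0 ≈ᴬ -ᴬ (w *ᴬ f 0) → (∀ n → g (suc n) ≈ᴬ f n -ᴬ w *ᴬ f (suc n)) →
      Converges q (λ n → f n *ᴬ z ^ᴬ n) v → Converges q (λ n → g n *ᴬ z ^ᴬ n) ((z -ᴬ w) *ᴬ v)
    converges-linear {f} {g} {z} {v} w g₀ g₊ (E , bound) = E′ , λ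
      { zero → bound-mono (≤-by (*-nonneg (+-nonneg (*-nonneg Z≥0 i≥0) W≥0) E≥0)
          (solve 2 (λ a b → (a :+ b) :* :1 :- a := b) refl K₀ ((Z * q ⁻¹ + W) * E)))
          (bound-exists (0ᴬ -ᴬ (z -ᴬ w) *ᴬ v))
      ; (suc n) → bound-cong (difference n) (bound-mono
          (≤-by (*-nonneg K₀≥0 (q^≥0 (suc n)))
            (trans (+-congˡ (-‿cong (+-congʳ (trans (sym (*-identityʳ _)) (*-congˡ (sym (⁻¹-inverseʳ q (>⇒≉ q>0))))))))
              (solve 7 (λ k Z W E q i x → (k :+ (Z :* i :+ W) :* E) :* (q :* x)
                  :- ((Z :* (E :* x)) :* (q :* i) :+ W :* (E :* (q :* x))) := k :* (q :* x))
                refl K₀ Z W E q (q ⁻¹) (q ^ n))))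
          (bound-+ (bound-* (bound-exists z) (bound n))
            (bound-neg (bound-* (bound-exists w) (bound (suc n)))))) }
      where
      u = λ n → f n *ᴬ z ^ᴬ n
      t = S (λ n → g n *ᴬ z ^ᴬ n)
      Z = ‖ z ‖
      W = ‖ w ‖
      K₀ = ‖ 0ᴬ -ᴬ (z -ᴬ w) *ᴬ v ‖
      Z≥0 = bound-nonneg (bound-exists z)
      W≥0 = bound-nonneg (bound-exists w)
      K₀≥0 = bound-nonneg (bound-exists (0ᴬ -ᴬ (z -ᴬ w) *ᴬ v))
      i≥0 = inj₁ (⁻¹-pos q>0)
      E≥0 : 0# ≤ E
      E≥0 = ≤-respʳ (*-identityʳ E) (bound-nonneg (bound 0))
      E′ = K₀ + (Z * q ⁻¹ + W) * E

      partial : ∀ n → t (suc n) ≈ᴬ z *ᴬ S u n -ᴬ w *ᴬ S u (suc n)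
      partial zero = transᴬ (+ᴬ-cong (*ᴬ-cong g₀ reflᴬ) reflᴬ)
        (solveᴬ 3 (λ z w f → (⊝ (w ⊗ f)) ⊗ :1ᴬ ⊕ :0ᴬ ⊜ z ⊗ :0ᴬ ⊝ w ⊗ (f ⊗ :1ᴬ ⊕ :0ᴬ)) reflᴬ z w (f 0))
      partial (suc n) = begin
        t (suc (suc n))                          ≈⟨ A⊛.sum-last (λ n → g n *ᴬ z ^ᴬ n) (suc n) ⟩
        t (suc n) +ᴬ g (suc n) *ᴬ z ^ᴬ suc n                 ≈⟨ +ᴬ-cong (partial n) (*ᴬ-cong (g₊ n) reflᴬ) ⟩
        (z *ᴬ S u n -ᴬ w *ᴬ S u (suc n)) +ᴬ (f n -ᴬ w *ᴬ f (suc n)) *ᴬ z ^ᴬ suc n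
          ≈⟨ solveᴬ 7 (λ z w s t f f′ p → (z ⊗ s ⊝ w ⊗ t) ⊕ (f ⊝ w ⊗ f′) ⊗ (z ⊗ p)
               ⊜ z ⊗ (s ⊕ f ⊗ p) ⊝ w ⊗ (t ⊕ f′ ⊗ (z ⊗ p))) reflᴬ z w (S u n) (S u (suc n)) (f n) (f (suc n)) (z ^ᴬ n) ⟩
        z *ᴬ (S u n +ᴬ u n) -ᴬ w *ᴬ (S u (suc n) +ᴬ u (suc n))
          ≈⟨ +ᴬ-cong (*ᴬ-cong reflᴬ (symᴬ (A⊛.sum-last u n))) (-ᴬ-cong (*ᴬ-cong reflᴬ (symᴬ (A⊛.sum-last u (suc n))))) ⟩
        z *ᴬ S u (suc n) -ᴬ w *ᴬ S u (suc (suc n)) ∎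

      difference : ∀ n → z *ᴬ (S u n -ᴬ v) +ᴬ (-ᴬ (w *ᴬ (S u (suc n) -ᴬ v))) ≈ᴬ t (suc n) -ᴬ (z -ᴬ w) *ᴬ v
      difference n = transᴬ
        (solveᴬ 5 (λ z w s t v → z ⊗ (s ⊝ v) ⊕ (⊝ (w ⊗ (t ⊝ v))) ⊜ (z ⊗ s ⊝ w ⊗ t) ⊝ (z ⊝ w) ⊗ v)
          reflᴬ z w (S u n) (S u (suc n)) v)
        (+ᴬ-cong (symᴬ (partial n)) reflᴬ)

    -- If the Cauchy product of two geometrically dominated series is 1, then the sum
    -- of the first one is not 0.  With T the partial sums of w and v′ their limit,
    --   S u (n + 1) v′ - 1 = ∑ uₖ (v′ - Tₙ₋ₖ)
    -- is O(n qⁿ), which is impossible if S u (n + 1) is O(qⁿ).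
    nonzero-sum : ∀ {u w : ℕ → A} {v C} → 0# ≤ C → (∀ n → Bound (u n) (C * q ^ n)) → Converges q u v →
      ∀ {v′} → Converges q w v′ → (u ⊛ w) 0 ≈ᴬ 1ᴬ → (∀ n → (u ⊛ w) (suc n) ≈ᴬ 0ᴬ) → ¬ (v ≈ᴬ 0ᴬ)
    nonzero-sum {u} {w} {v} {C} C≥0 u-bound (E , S-bound) {v′} (E′ , T-bound) uw₀ uw v≈0 =
      linear-times-geometric-small em q>0 q<1 (+-nonneg (*-nonneg E≥0 M≥0) (*-nonneg C≥0 E′≥0)) one-bounded
      where
      E≥0 : 0# ≤ E
      E≥0 = ≤-respʳ (*-identityʳ E) (bound-nonneg (S-bound 0))
      E′≥0 : 0# ≤ E′
      E′≥0 = ≤-respʳ (*-identityʳ E′) (bound-nonneg (T-bound 0))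
      M = ‖ v′ ‖
      M≥0 = bound-nonneg (bound-exists v′)

      -- Indexed so that T 0 is the first term.
      T : ℕ → A
      T n = S w (suc n)

      u⊛T : ∀ n → (u ⊛ T) n ≈ᴬ 1ᴬ
      u⊛T zero = transᴬ (solveᴬ 2 (λ a b → a ⊗ (b ⊕ :0ᴬ) ⊕ :0ᴬ ⊜ a ⊗ b ⊕ :0ᴬ) reflᴬ (u 0) (w 0)) uw₀
      u⊛T (suc n) = begin
        (u ⊛ T) (suc n)                                     ≈⟨ A⊛.⊛-last u T n ⟩
        (u ⊛ (T ∘ suc)) n +ᴬ u (suc n) *ᴬ T 0
          ≈⟨ +ᴬ-cong (transᴬ (A⊛.⊛-cong {f = u} (λ _ → reflᴬ) (λ k → transᴬ (A⊛.sum-last w (suc k))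
               (solveᴬ 2 (λ a b → a ⊕ b ⊜ :1ᴬ ⊗ a ⊕ b) reflᴬ (T k) (w (suc k)))) n)
               (A⊛.⊛-linearʳ 1ᴬ u T (w ∘ suc) n)) reflᴬ ⟩
        (1ᴬ *ᴬ (u ⊛ T) n +ᴬ (u ⊛ (w ∘ suc)) n) +ᴬ u (suc n) *ᴬ T 0
          ≈⟨ solveᴬ 4 (λ a b c d → (:1ᴬ ⊗ a ⊕ b) ⊕ c ⊗ (d ⊕ :0ᴬ) ⊜ a ⊕ (b ⊕ c ⊗ d)) reflᴬ ((u ⊛ T) n) _ (u (suc n)) (w 0) ⟩
        (u ⊛ T) n +ᴬ ((u ⊛ (w ∘ suc)) n +ᴬ u (suc n) *ᴬ w 0)
          ≈⟨ +ᴬ-cong (u⊛T n) (transᴬ (symᴬ (A⊛.⊛-last u w n)) (uw n)) ⟩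
        1ᴬ +ᴬ 0ᴬ                                            ≈⟨ solveᴬ 0 (:1ᴬ ⊕ :0ᴬ ⊜ :1ᴬ) reflᴬ ⟩
        1ᴬ                                                  ∎

      ⊛-bound : ∀ n {u h : ℕ → A} {C} → (∀ k → Bound (u k) (C * q ^ k)) → (∀ k → Bound (h k) (E′ * q ^ k)) →
        Bound ((u ⊛ h) n) (fromℕ (suc n) * (C * E′ * q ^ n))
      ⊛-bound zero {u} {h} {C} p r = bound-cong (solveᴬ 2 (λ a b → a ⊗ b ⊜ a ⊗ b ⊕ :0ᴬ) reflᴬ (u 0) (h 0))
        (bound-mono (inj₂ (solve 2 (λ C E → (C :* :1) :* (E :* :1) := (:1 :+ :0) :* (C :* E :* :1)) refl C E′))
          (bound-* (p 0) (r 0)))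
      ⊛-bound (suc n) {u} {h} {C} p r = bound-mono
        (inj₂ (solve 5 (λ C E q x n → (C :* :1) :* (E :* (q :* x)) :+ (:1 :+ n) :* ((C :* q) :* E :* x)
             := (:1 :+ (:1 :+ n)) :* (C :* E :* (q :* x))) refl C E′ q (q ^ n) (fromℕ n)))
        (bound-+ (bound-* (p 0) (r (suc n)))
          (⊛-bound n {u ∘ suc} {h} {C * q} (λ k → bound-mono (inj₂ (sym (*-assoc C q (q ^ k)))) (p (suc k))) r))

      h : ℕ → A
      h n = -ᴬ 1ᴬ *ᴬ T n +ᴬ v′

      h-bound : ∀ n → Bound (h n) (E′ * q ^ n)
      h-bound n = bound-cong (solveᴬ 2 (λ t v → ⊝ (t ⊝ v) ⊜ (⊝ :1ᴬ) ⊗ t ⊕ v) reflᴬ (T n) v′)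
        (bound-mono (≤-by (*-nonneg E′≥0 (*-nonneg (q^≥0 n) (inj₁ 1-q>0)))
            (solve 3 (λ E q x → E :* x :- E :* (q :* x) := E :* (x :* (:1 :- q))) refl E′ q (q ^ n)))
          (bound-neg (T-bound (suc n))))

      u⊛h : ∀ n → (u ⊛ h) n ≈ᴬ S u (suc n) *ᴬ v′ -ᴬ 1ᴬ
      u⊛h n = begin
        (u ⊛ h) n                                    ≈⟨ A⊛.⊛-linearʳ (-ᴬ 1ᴬ) u T (λ _ → v′) n ⟩
        -ᴬ 1ᴬ *ᴬ (u ⊛ T) n +ᴬ (u ⊛ (λ _ → v′)) n    ≈⟨ +ᴬ-cong (*ᴬ-cong reflᴬ (u⊛T n)) (A⊛.⊛-constantʳ u v′ n) ⟩
        -ᴬ 1ᴬ *ᴬ 1ᴬ +ᴬ S u (suc n) *ᴬ v′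
          ≈⟨ solveᴬ 1 (λ x → (⊝ :1ᴬ) ⊗ :1ᴬ ⊕ x ⊜ x ⊝ :1ᴬ) reflᴬ _ ⟩
        S u (suc n) *ᴬ v′ -ᴬ 1ᴬ                      ∎

      one-bounded : ∀ n → 1# ≤ fromℕ (suc n) * ((E * M + C * E′) * q ^ n)
      one-bounded n = ≤-trans
        (bound-1 (bound-cong
          (transᴬ (+ᴬ-cong (*ᴬ-cong (transᴬ (+ᴬ-cong reflᴬ (-ᴬ-cong v≈0)) (solveᴬ 1 (λ s → s ⊝ :0ᴬ ⊜ s) reflᴬ (S u (suc n)))) reflᴬ)
                     (-ᴬ-cong (u⊛h n)))
            (solveᴬ 1 (λ x → x ⊝ (x ⊝ :1ᴬ) ⊜ :1ᴬ) reflᴬ (S u (suc n) *ᴬ v′)))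
          (bound-+ (bound-* (S-bound (suc n)) (bound-exists v′)) (bound-neg (⊛-bound n u-bound h-bound)))))
        (≤-by (*-nonneg (*-nonneg E≥0 M≥0) (*-nonneg (q^≥0 n) (+-nonneg (inj₁ 1-q>0) (fromℕ-nonneg n))))
          (solve 7 (λ E M C F q x n → (:1 :+ n) :* ((E :* M :+ C :* F) :* x)
               :- ((E :* (q :* x)) :* M :+ (:1 :+ n) :* (C :* F :* x)) := (E :* M) :* (x :* ((:1 :- q) :+ n)))
            refl E M C E′ q (q ^ n) (fromℕ n)))

-- Complex numbers

module ComplexNumbers (ℝ : CompleteOrderedField) where

  open CompleteOrderedField ℝ renaming (zero to *-zero)
  open Eulerian ℝ
  open OrderedField ℝ

  ℂ-commutativeRing : CommutativeRing 0ℓ 0ℓ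
  ℂ-commutativeRing = record
    { Carrier = ℂ ; _≈_ = _≈ᶜ_ ; _+_ = _+ᶜ_ ; _*_ = _*ᶜ_ ; -_ = -ᶜ_ ; 0# = 0ᶜ ; 1# = 1ᶜ
    ; isCommutativeRing = record
      { isRing = record
        { +-isAbelianGroup = record
          { isGroup = record
            { isMonoid = record
              { isSemigroup = record
                { isMagma = record
                  { isEquivalence = record
                    { refl = refl , refl
                    ; sym = λ (p , q) → sym p , sym q
                    ; trans = λ (p , q) (p′ , q′) → trans p p′ , trans q q′ }
                  ; ∙-cong = λ (p , q) (p′ , q′) → +-cong p p′ , +-cong q q′ }
                ; assoc = λ u v w → +-assoc _ _ _ , +-assoc _ _ _ }
              ; identity = (λ u → +-identityˡ _ , +-identityˡ _) , (λ u → +-identityʳ _ , +-identityʳ _) }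
            ; inverse = (λ u → -‿inverseˡ _ , -‿inverseˡ _) , (λ u → -‿inverseʳ _ , -‿inverseʳ _)
            ; ⁻¹-cong = λ (p , q) → -‿cong p , -‿cong q }
          ; comm = λ u v → +-comm _ _ , +-comm _ _ }
        ; *-cong = λ (p , q) (p′ , q′) →
            +-cong (*-cong p p′) (-‿cong (*-cong q q′)) , +-cong (*-cong p q′) (*-cong q p′)
        ; *-assoc = λ u v w →
            solve 6 (λ a b c d e f → (a :* c :- b :* d) :* e :- (a :* d :+ b :* c) :* f
                                  := a :* (c :* e :- d :* f) :- b :* (c :* f :+ d :* e))
              refl (re u) (im u) (re v) (im v) (re w) (im w) ,
            solve 6 (λ a b c d e f → (a :* c :- b :* d) :* f :+ (a :* d :+ b :* c) :* e
                                  := a :* (c :* f :+ d :* e) :+ b :* (c :* e :- d :* f))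
              refl (re u) (im u) (re v) (im v) (re w) (im w)
        ; *-identity =
            (λ u → solve 2 (λ a b → :1 :* a :- :0 :* b := a) refl (re u) (im u) ,
                   solve 2 (λ a b → :1 :* b :+ :0 :* a := b) refl (re u) (im u)) ,
            (λ u → solve 2 (λ a b → a :* :1 :- b :* :0 := a) refl (re u) (im u) ,
                   solve 2 (λ a b → a :* :0 :+ b :* :1 := b) refl (re u) (im u))
        ; distrib =
            (λ u v w →
              solve 6 (λ a b c d e f → a :* (c :+ e) :- b :* (d :+ f) := (a :* c :- b :* d) :+ (a :* e :- b :* f))
                refl (re u) (im u) (re v) (im v) (re w) (im w) ,
              solve 6 (λ a b c d e f → a :* (d :+ f) :+ b :* (c :+ e) := (a :* d :+ b :* c) :+ (a :* f :+ b :* e))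
                refl (re u) (im u) (re v) (im v) (re w) (im w)) ,
            (λ u v w →
              solve 6 (λ a b c d e f → (c :+ e) :* a :- (d :+ f) :* b := (c :* a :- d :* b) :+ (e :* a :- f :* b))
                refl (re u) (im u) (re v) (im v) (re w) (im w) ,
              solve 6 (λ a b c d e f → (c :+ e) :* b :+ (d :+ f) :* a := (c :* b :+ d :* a) :+ (e :* b :+ f :* a))
                refl (re u) (im u) (re v) (im v) (re w) (im w)) }
      ; *-comm = λ u v →
          solve 4 (λ a b c d → a :* c :- b :* d := c :* a :- d :* b) refl (re u) (im u) (re v) (im v) ,
          solve 4 (λ a b c d → a :* d :+ b :* c := c :* b :+ d :* a) refl (re u) (im u) (re v) (im v) } }

  open CommutativeRing ℂ-commutativeRing public using ()
    renaming (refl to reflᶜ; sym to symᶜ; trans to transᶜ; +-cong to +ᶜ-cong; *-cong to *ᶜ-cong; setoid to ℂ-setoid)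

  ι-cong : ∀ {x y} → x ≈ y → ι x ≈ᶜ ι y
  ι-cong e = e , refl

  ι-+ : ∀ x y → ι (x + y) ≈ᶜ ι x +ᶜ ι y
  ι-+ x y = refl , sym (+-identityˡ 0#)

  ι-* : ∀ x y → ι (x * y) ≈ᶜ ι x *ᶜ ι y
  ι-* x y = solve 2 (λ x y → x :* y := x :* y :- :0 :* :0) refl x y ,
            solve 2 (λ x y → :0 := x :* :0 :+ :0 :* y) refl x y

  ∣∣²-cong : ∀ {z w} → z ≈ᶜ w → ∣ z ∣² ≈ ∣ w ∣²
  ∣∣²-cong (p , q) = +-cong (*-cong p p) (*-cong q q)

  ∣∣²-nonneg : ∀ z → 0# ≤ ∣ z ∣²
  ∣∣²-nonneg z = +-nonneg (square-nonneg (re z)) (square-nonneg (im z))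

  -- Multiplication by the conjugate of w reduces w v = 0 to ∣w∣² v = 0.
  *ᶜ-≉0 : ∀ {w v} → 0# < ∣ w ∣² → ¬ (v ≈ᶜ 0ᶜ) → ¬ (w *ᶜ v ≈ᶜ 0ᶜ)
  *ᶜ-≉0 {a +i b} {c +i d} w>0 v≉0 (p , q) = v≉0 (
    *-cancelˡ-≈0 (>⇒≉ w>0) (trans (solve 4 (λ a b c d → (a :* a :+ b :* b) :* c :=
        a :* (a :* c :- b :* d) :+ b :* (a :* d :+ b :* c)) refl a b c d)
      (trans (+-cong (trans (*-congˡ p) (zeroʳ a)) (trans (*-congˡ q) (zeroʳ b))) (+-identityˡ 0#))) ,
    *-cancelˡ-≈0 (>⇒≉ w>0) (trans (solve 4 (λ a b c d → (a :* a :+ b :* b) :* d :=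
        a :* (a :* d :+ b :* c) :- b :* (a :* c :- b :* d)) refl a b c d)
      (trans (+-cong (trans (*-congˡ q) (zeroʳ a)) (-‿cong (trans (*-congˡ p) (zeroʳ b)))) (-‿inverseʳ 0#))))

  -- ∣z∣ ≤ r, stated without square roots.
  Bound : ℂ → Carrier → Set
  Bound z r = 0# ≤ r × ∣ z ∣² ≤ r * r

  bound-cong : ∀ {z w r} → z ≈ᶜ w → Bound z r → Bound w r
  bound-cong e (p , q) = p , ≤-respˡ (∣∣²-cong e) q

  bound-mono : ∀ {z r s} → r ≤ s → Bound z r → Bound z s
  bound-mono {r = r} {s} r≤s (p , q) = ≤-trans p r≤s , ≤-trans q
    (≤-by (*-nonneg (difference-nonneg r≤s) (+-nonneg (≤-trans p r≤s) p))
      (solve 2 (λ r s → s :* s :- r :* r := (s :- r) :* (s :+ r)) refl r s))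

  bound-exists : ∀ z → Bound z (1# + ∣ z ∣²)
  bound-exists z = +-nonneg (inj₁ 0<1) n≥0 , ≤-by (+-nonneg (+-nonneg (inj₁ 0<1) n≥0) (*-nonneg n≥0 n≥0))
    (solve 1 (λ n → (:1 :+ n) :* (:1 :+ n) :- n := (:1 :+ n) :+ n :* n) refl ∣ z ∣²)
    where n≥0 = ∣∣²-nonneg z

  bound-neg : ∀ {z r} → Bound z r → Bound (-ᶜ z) r
  bound-neg {z} (p , q) = p , ≤-respˡ
    (solve 2 (λ a b → a :* a :+ b :* b := :- a :* :- a :+ :- b :* :- b) refl (re z) (im z)) q

  bound-re : ∀ {z r} → Bound z r → re z ≤ r
  bound-re {z} (p , q) = square-cancel-≤ p (≤-trans (≤-by (square-nonneg (im z))
    (solve 2 (λ a b → (a :+ b) :- a := b) refl _ _)) q)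

  bound-im : ∀ {z r} → Bound z r → im z ≤ r
  bound-im {z} (p , q) = square-cancel-≤ p (≤-trans (≤-by (square-nonneg (re z))
    (solve 2 (λ a b → (a :+ b) :- b := a) refl _ _)) q)

  bound-ι : ∀ {x r} → 0# ≤ r → x ≤ r → - x ≤ r → Bound (ι x) r
  bound-ι {x} {r} r≥0 p q = r≥0 , ≤-by (*-nonneg (difference-nonneg p) (difference-nonneg q))
    (solve 2 (λ x r → r :* r :- (x :* x :+ :0 :* :0) := (r :- x) :* (r :- :- x)) refl x r)

  bound-+ : ∀ {z w r s} → Bound z r → Bound w s → Bound (z +ᶜ w) (r + s)
  bound-+ {a +i b} {c +i d} {r} {s} (r≥0 , p) (s≥0 , q) = +-nonneg r≥0 s≥0 ,
    ≤-by (+-nonneg (+-nonneg (difference-nonneg p) (difference-nonneg q))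
           (+-nonneg (difference-nonneg cauchy-schwarz) (difference-nonneg cauchy-schwarz)))
      (solve 6 (λ a b c d r s → (r :+ s) :* (r :+ s) :- ((a :+ c) :* (a :+ c) :+ (b :+ d) :* (b :+ d)) :=
          ((r :* r :- (a :* a :+ b :* b)) :+ (s :* s :- (c :* c :+ d :* d)))
          :+ ((r :* s :- (a :* c :+ b :* d)) :+ (r :* s :- (a :* c :+ b :* d))))
        refl a b c d r s)
    where
    -- The difference of the squares contains (a d - b c)².
    cauchy-schwarz : a * c + b * d ≤ r * s
    cauchy-schwarz = square-cancel-≤ (*-nonneg r≥0 s≥0) (≤-by
      (+-nonneg (square-nonneg (a * d - b * c))
        (+-nonneg (*-nonneg (difference-nonneg p) (*-nonneg s≥0 s≥0))
                  (*-nonneg (∣∣²-nonneg (a +i b)) (difference-nonneg q))))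
      (solve 6 (λ a b c d r s → (r :* s) :* (r :* s) :- (a :* c :+ b :* d) :* (a :* c :+ b :* d) :=
          (a :* d :- b :* c) :* (a :* d :- b :* c) :+ ((r :* r :- (a :* a :+ b :* b)) :* (s :* s)
          :+ (a :* a :+ b :* b) :* (s :* s :- (c :* c :+ d :* d))))
        refl a b c d r s))

  bound-* : ∀ {z w r s} → Bound z r → Bound w s → Bound (z *ᶜ w) (r * s)
  bound-* {a +i b} {c +i d} {r} {s} (r≥0 , p) (s≥0 , q) = *-nonneg r≥0 s≥0 ,
    ≤-by (+-nonneg (*-nonneg (difference-nonneg p) (*-nonneg s≥0 s≥0))
                   (*-nonneg (∣∣²-nonneg (a +i b)) (difference-nonneg q)))
      (solve 6 (λ a b c d r s →
          (r :* s) :* (r :* s) :- ((a :* c :- b :* d) :* (a :* c :- b :* d) :+ (a :* d :+ b :* c) :* (a :* d :+ b :* c)) :=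
          (r :* r :- (a :* a :+ b :* b)) :* (s :* s) :+ (a :* a :+ b :* b) :* (s :* s :- (c :* c :+ d :* d)))
        refl a b c d r s)

  bound-components : ∀ {z r} → 0# ≤ r → re z ≤ r → - re z ≤ r → im z ≤ r → - im z ≤ r → Bound z (r + r)
  bound-components {a +i b} {r} r≥0 p p′ q q′ = +-nonneg r≥0 r≥0 ,
    ≤-by (+-nonneg (+-nonneg (*-nonneg (difference-nonneg p) (difference-nonneg p′))
                             (*-nonneg (difference-nonneg q) (difference-nonneg q′)))
                   (+-nonneg (*-nonneg r≥0 r≥0) (*-nonneg r≥0 r≥0)))
      (solve 3 (λ a b r → (r :+ r) :* (r :+ r) :- (a :* a :+ b :* b) :=
          ((r :- a) :* (r :- :- a) :+ (r :- b) :* (r :- :- b)) :+ (r :* r :+ r :* r)) refl a b r)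

  ℂ-normedRing : NormedRing ℝ
  ℂ-normedRing = record
    { commutativeRing = ℂ-commutativeRing ; Bound = Bound ; bound-nonneg = proj₁
    ; bound-cong = λ {z} {w} → bound-cong {z} {w} ; bound-mono = λ {z} → bound-mono {z}
    ; bound-+ = bound-+ ; bound-* = bound-* ; bound-neg = λ {z} → bound-neg {z}
    ; bound-0 = ≤-refl , inj₂ (solve 0 (:0 :* :0 :+ :0 :* :0 := :0 :* :0) refl)
    ; bound-1 = λ { b → bound-re b }
    ; ‖_‖ = λ z → 1# + ∣ z ∣² ; bound-exists = bound-exists ; complete = complete }
    where
    forward : ∀ {x y e} → x - y ≤ e → x ≤ y + e
    forward {x} {y} {e} p = ≤-by (difference-nonneg p)
      (solve 3 (λ x y e → (y :+ e) :- x := e :- (x :- y)) refl x y e)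

    backward : ∀ {x y e} → - (x - y) ≤ e → y ≤ x + e
    backward {x} {y} {e} p = ≤-by (difference-nonneg p)
      (solve 3 (λ x y e → (x :+ e) :- y := e :- :- (x :- y)) refl x y e)

    forward⁻¹ : ∀ {x y e} → x ≤ y + e → x - y ≤ e
    forward⁻¹ {x} {y} {e} p = ≤-by (difference-nonneg p)
      (solve 3 (λ x v e → e :- (x :- v) := (v :+ e) :- x) refl x y e)

    backward⁻¹ : ∀ {x y e} → y ≤ x + e → - (x - y) ≤ e
    backward⁻¹ {x} {y} {e} p = ≤-by (difference-nonneg p)
      (solve 3 (λ x v e → e :- :- (x :- v) := (x :+ e) :- v) refl x y e)

    complete : ∀ (x : ℕ → ℂ) (e : ℕ → Carrier) → (∀ n → 0# ≤ e n) →
      (∀ n k → Bound (x (k ℕ.+ n) -ᶜ x n) (e n)) → ∃[ v ] (∀ n → Bound (x n -ᶜ v) (e n + e n))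
    complete x e e≥0 tail =
      let a , a-lim = cauchy-limit (λ n → re (x n)) e e≥0
            (λ n k → backward (bound-re (bound-neg (tail n k)))) (λ n k → forward (bound-re (tail n k)))
          b , b-lim = cauchy-limit (λ n → im (x n)) e e≥0
            (λ n k → backward (bound-im (bound-neg (tail n k)))) (λ n k → forward (bound-im (tail n k)))
      in (a +i b) , λ n → bound-components (e≥0 n)
           (forward⁻¹ (proj₂ (a-lim n))) (backward⁻¹ (proj₁ (a-lim n)))
           (forward⁻¹ (proj₂ (b-lim n))) (backward⁻¹ (proj₁ (b-lim n)))

-- The binomial series in the unit disc

module BinomialSums (em : ExcludedMiddle 0ℓ) (ℝ : CompleteOrderedField) where

  open CompleteOrderedField ℝ renaming (zero to *-zero)
  open Eulerian ℝ
  open OrderedField ℝ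
  open ComplexNumbers ℝ
  open NormedSeries em ℝ ℂ-normedRing
  open BinomialSeries ℝ using (binomialSeries-0; binomialSeries-suc; binomialSeries-inverse)
  open import Algebra.Definitions.RawSemiring (Semiring.rawSemiring semiring) using (_^_)
  open import Relation.Binary.Reasoning.Setoid ℂ-setoid
  private
    module ℝ⊛ = CauchyProduct commutativeRing
    module ℂ⊛ = CauchyProduct ℂ-commutativeRing
  open ℂ⊛ using (_⊛_)
  private
    module ℂ* where
      open import Algebra.Properties.CommutativeSemigroup
        (CommutativeRing.*-commutativeSemigroup ℂ-commutativeRing) public using (interchange)

  converges⇒hasSum : ∀ {q} → 0# < q → q < 1# → ∀ f {z v} → Converges q (λ n → f n *ᶜ z ^ᶜ n) v → HasSum f z v
  converges⇒hasSum {q} q>0 q<1 f (E , bound) ε ε>0 =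
    let N , small = geometric-small em {E = E} q>0 q<1 ε>0
    in N , λ n N≤n → let r≥0 , b = bound n ; r<ε = small n N≤n in
      ≤-<-trans b (<-by (*-pos (difference-pos r<ε) (+-pos-nonneg ε>0 r≥0))
        (solve 2 (λ r ε → ε :* ε :- r :* r := (ε :- r) :* (ε :+ r)) refl (E * q ^ n) ε))

  -- The terms of the binomial series at z.
  term : Carrier → ℂ → ℕ → ℂ
  term s z n = ι (binomialSeries s n) *ᶜ z ^ᶜ n

  -- For ∣z∣ ≤ q² with q < 1 the ratios of consecutive terms, ((s + n)/(n + 1)) z, are
  -- eventually bounded by q.
  term-bound : ∀ {q} → 0# < q → q < 1# → ∀ s {z} → Bound z (q * q) →
    ∃[ C ] (0# ≤ C × (∀ n → Bound (term s z n) (C * q ^ n)))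
  term-bound {q} q>0 q<1 s {z} z-bound = ratio-test q>0 q<1 N (term s z) λ n N≤n {r} b →
      bound-cong (symᶜ (ratio n)) (bound-* (ratio-bound n N≤n) b)
    where
    1-q>0 = difference-pos q<1

    -- σ bounds ∣s∣, and (σ + n) q² ≤ (n + 1) q as soon as σ ≤ (1 - q) n.
    σ = s * s + 1#
    σ≥0 = +-nonneg (square-nonneg s) (inj₁ 0<1)
    large-N = archimedean em (σ * (1# - q) ⁻¹)
    N = proj₁ large-N

    σ≤ : ∀ n → N ℕ.≤ n → σ ≤ (1# - q) * fromℕ n
    σ≤ n N≤n = ≤-trans (inj₁ (<-by (*-pos 1-q>0 (difference-pos (proj₂ large-N)))
      (trans (+-congˡ (-‿cong (trans (sym (*-identityʳ σ)) (*-congˡ (sym (⁻¹-inverseʳ _ (>⇒≉ 1-q>0)))))))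
        (solve 4 (λ n D K i → D :* n :- K :* (D :* i) := D :* (n :- K :* i)) refl
          (fromℕ N) (1# - q) σ ((1# - q) ⁻¹))))) (*-monoˡ-≤ (inj₁ 1-q>0) (fromℕ-mono N≤n))

    i : ℕ → Carrier
    i n = fromℕ (suc n) ⁻¹

    i≥0 : ∀ n → 0# ≤ i n
    i≥0 n = inj₁ (⁻¹-pos (fromℕ-pos n))

    inverse : ∀ n → fromℕ (suc n) * i n ≈ 1#
    inverse n = ⁻¹-inverseʳ _ (fromℕ-≉0 (suc n))

    s≤σ : ∀ s → s ≤ s * s + 1#
    s≤σ s with square-nonneg (s - 1#) | square-nonneg s
    ... | p | p′ = ≤-by (*-cancelˡ-nonneg (+-pos-nonneg 0<1 (inj₁ 0<1))
        (≤-respʳ (solve 1 (λ s → ((s :- :1) :* (s :- :1) :+ s :* s) :+ :1 := (:1 :+ :1) :* (s :* s :+ :1 :- s)) refl s)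
          (+-nonneg (+-nonneg p p′) (inj₁ 0<1)))) refl

    ratio : ∀ n → term s z (suc n) ≈ᶜ (ι ((s + fromℕ n) * i n) *ᶜ z) *ᶜ term s z n
    ratio n = begin
      ι (binomialSeries s (suc n)) *ᶜ p
        ≈⟨ *ᶜ-cong {ι (binomialSeries s (suc n))} {ι (x * i n * b)} {p} {p} (ι-cong coefficient) (reflᶜ {p}) ⟩
      ι (x * i n * b) *ᶜ p
        ≈⟨ *ᶜ-cong {ι (x * i n * b)} {ι (x * i n) *ᶜ ι b} {p} {p} (ι-* (x * i n) b) (reflᶜ {p}) ⟩
      (ι (x * i n) *ᶜ ι b) *ᶜ (z *ᶜ z ^ᶜ n)
        ≈⟨ ℂ*.interchange (ι (x * i n)) (ι b) z (z ^ᶜ n) ⟩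
      (ι (x * i n) *ᶜ z) *ᶜ term s z n ∎
      where
      p = z *ᶜ z ^ᶜ n
      x = s + fromℕ n
      b = binomialSeries s n

      coefficient : binomialSeries s (suc n) ≈ x * i n * b
      coefficient = trans (sym (*-identityˡ _)) (trans (*-congʳ (sym (inverse n)))
        (trans (solve 3 (λ k i b → (k :* i) :* b := i :* (k :* b)) refl (fromℕ (suc n)) (i n) (binomialSeries s (suc n)))
          (trans (*-congˡ (binomialSeries-suc s n))
            (solve 3 (λ i x b → i :* (x :* b) := (x :* i) :* b) refl (i n) x b))))

    ratio-bound : ∀ n → N ℕ.≤ n → Bound (ι ((s + fromℕ n) * i n) *ᶜ z) q
    ratio-bound n N≤n = bound-mono
      (≤-by (*-nonneg (inj₁ q>0) (*-nonneg (i≥0 n) (+-nonneg (inj₁ 0<1)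
          (+-nonneg (difference-nonneg (σ≤ n N≤n)) (*-nonneg σ≥0 (inj₁ 1-q>0))))))
        (trans (+-congʳ (trans (sym (*-identityʳ q)) (*-congˡ (sym (inverse n)))))
          (solve 4 (λ q n i σ → q :* ((:1 :+ n) :* i) :- ((σ :+ n) :* i) :* (q :* q) :=
              q :* (i :* (:1 :+ (((:1 :- q) :* n :- σ) :+ σ :* (:1 :- q))))) refl q (fromℕ n) (i n) σ)))
      (bound-* (bound-ι (*-nonneg (+-nonneg σ≥0 (fromℕ-nonneg n)) (i≥0 n))
          (≤-by (*-nonneg (i≥0 n) (difference-nonneg (s≤σ s)))
            (solve 4 (λ σ s n i → (σ :+ n) :* i :- (s :+ n) :* i := i :* (σ :- s)) refl σ s (fromℕ n) (i n)))
          (≤-by (*-nonneg (i≥0 n) (+-nonneg (difference-nonneg (s≤σ (- s))) (+-nonneg (fromℕ-nonneg n) (fromℕ-nonneg n))))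
            (solve 3 (λ s n i → ((s :* s :+ :1) :+ n) :* i :- :- ((s :+ n) :* i)
                := i :* (((:- s) :* (:- s) :+ :1 :- :- s) :+ (n :+ n))) refl s (fromℕ n) (i n))))
        z-bound)

  -- The embedding of the real numbers preserves Cauchy products.
  ι-⊛ : ∀ f g n → ((ι ∘ f) ⊛ (ι ∘ g)) n ≈ᶜ ι ((f ℝ⊛.⊛ g) n)
  ι-⊛ f g zero = begin
    ι (f 0) *ᶜ ι (g 0) +ᶜ 0ᶜ      ≈⟨ +ᶜ-cong {ι (f 0) *ᶜ ι (g 0)} {ι (f 0 * g 0)} {0ᶜ} {0ᶜ}
                                       (symᶜ {ι (f 0 * g 0)} {ι (f 0) *ᶜ ι (g 0)} (ι-* (f 0) (g 0))) (reflᶜ {0ᶜ}) ⟩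
    ι (f 0 * g 0) +ᶜ 0ᶜ           ≈⟨ ι-+ (f 0 * g 0) 0# ⟨
    ι (f 0 * g 0 + 0#)            ∎
  ι-⊛ f g (suc n) = begin
    ι (f 0) *ᶜ ι y +ᶜ ((ι ∘ f ∘ suc) ⊛ (ι ∘ g)) n
      ≈⟨ +ᶜ-cong {ι (f 0) *ᶜ ι y} {ι (f 0 * y)} {((ι ∘ f ∘ suc) ⊛ (ι ∘ g)) n} {ι w}
           (symᶜ {ι (f 0 * y)} {ι (f 0) *ᶜ ι y} (ι-* (f 0) y)) (ι-⊛ (f ∘ suc) g n) ⟩
    ι (f 0 * y) +ᶜ ι w
      ≈⟨ ι-+ (f 0 * y) w ⟨
    ι (f 0 * y + w) ∎
    where
    y = g (suc n)
    w = ((f ∘ suc) ℝ⊛.⊛ g) n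

  terms-inverse : ∀ s z n → (term s z ⊛ term (- s) z) (suc n) ≈ᶜ 0ᶜ
  terms-inverse s z n = begin
    (term s z ⊛ term (- s) z) (suc n)        ≈⟨ ℂ⊛.⊛-rescale z b b⁻ (suc n) ⟩
    (b ⊛ b⁻) (suc n) *ᶜ p                    ≈⟨ *ᶜ-cong {(b ⊛ b⁻) (suc n)} {0ᶜ} {p} {p} vanish (reflᶜ {p}) ⟩
    0ᶜ *ᶜ p                                  ≈⟨ CommutativeRing.zeroˡ ℂ-commutativeRing p ⟩
    0ᶜ                                       ∎
    where
    b  = ι ∘ binomialSeries s
    b⁻ = ι ∘ binomialSeries (- s)
    p  = z ^ᶜ suc n

    vanish : (b ⊛ b⁻) (suc n) ≈ᶜ 0ᶜ
    vanish = transᶜ {(b ⊛ b⁻) (suc n)} {ι ((binomialSeries s ℝ⊛.⊛ binomialSeries (- s)) (suc n))} {0ᶜ}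
      (ι-⊛ (binomialSeries s) (binomialSeries (- s)) (suc n)) (ι-cong (binomialSeries-inverse s n))

  terms-inverse-0 : ∀ s z → (term s z ⊛ term (- s) z) 0 ≈ᶜ 1ᶜ
  terms-inverse-0 s z = begin
    (term s z ⊛ term (- s) z) 0              ≈⟨ ℂ⊛.⊛-rescale z b b⁻ 0 ⟩
    (b ⊛ b⁻) 0 *ᶜ 1ᶜ                         ≈⟨ CommutativeRing.*-identityʳ ℂ-commutativeRing ((b ⊛ b⁻) 0) ⟩
    (b ⊛ b⁻) 0                               ≈⟨ ι-⊛ (binomialSeries s) (binomialSeries (- s)) 0 ⟩
    ι (binomialSeries s 0 * binomialSeries (- s) 0 + 0#)
      ≈⟨ ι-cong (trans (+-identityʳ _) (trans (*-cong (binomialSeries-0 s) (binomialSeries-0 (- s))) (*-identityˡ 1#))) ⟩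
    1ᶜ                                       ∎
    where
    b  = ι ∘ binomialSeries s
    b⁻ = ι ∘ binomialSeries (- s)

  -- The binomial series converges in the unit disc, to a nonzero value because its
  -- product with the series for - s is 1.
  binomial-sum : ∀ s z → InUnitDisc z →
    ∃[ q ] (0# < q × q < 1# × ∃[ v ] (¬ (v ≈ᶜ 0ᶜ) × Converges q (term s z) v))
  binomial-sum s z z<1 =
    let t , t>0 , t<1 , ∣z∣≤t = square-above (∣∣²-nonneg z) z<1
        q , q>0 , q<1 , t≤q² = square-above (inj₁ t>0) t<1
        z-bound = bound-mono t≤q² (inj₁ t>0 , ∣z∣≤t)
        C , C≥0 , u-bound = term-bound q>0 q<1 s z-bound
        C′ , C′≥0 , w-bound = term-bound q>0 q<1 (- s) z-bound
        v , u-lim = geometric-limit q>0 q<1 (term s z) C C≥0 u-bound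
        v′ , w-lim = geometric-limit q>0 q<1 (term (- s) z) C′ C′≥0 w-bound
    -- ∣z∣² ≤ t² and t ≤ q², so that ∣z∣ ≤ q².
    in q , q>0 , q<1 , v ,
       nonzero-sum q>0 q<1 C≥0 u-bound u-lim w-lim (terms-inverse-0 s z) (terms-inverse s z) , u-lim

  ∣ι∣²-pos : ∀ {c} → c ≉ 0# → 0# < ∣ ι c ∣²
  ∣ι∣²-pos {c} c≉0 = ≰⇒> λ p → *-≉0 c≉0 c≉0 (≯≮⇒≈
    (λ q → <⇒≱ q (≤-respˡ (solve 1 (λ c → c :* c :+ :0 :* :0 := c :* c) refl c) p))
    (λ q → <⇒≱ q (square-nonneg c)))

  scaled : ∀ {q} → 0# < q → q < 1# → ∀ s c z {v} → Converges q (term s z) v →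
    Converges q (λ n → (ι c *ᶜ ι (binomialSeries s n)) *ᶜ z ^ᶜ n) (ι c *ᶜ v)
  scaled q>0 q<1 s c z {v} lim = converges-scale q>0 q<1 {f = ι ∘ binomialSeries s} {z = z} {v = v} (ι c)
    (λ n → reflᶜ {ι c *ᶜ ι (binomialSeries s n)}) lim

  zeroFree-constant-times : ∀ s {c} → c ≉ 0# → ZeroFreeOnDisc (λ n → ι c *ᶜ ι (binomialSeries s n))
  zeroFree-constant-times s {c} c≉0 z z<1 =
    let q , q>0 , q<1 , v , v≉0 , lim = binomial-sum s z z<1
    in ι c *ᶜ v , *ᶜ-≉0 (∣ι∣²-pos c≉0) v≉0 ,
       converges⇒hasSum q>0 q<1 (λ n → ι c *ᶜ ι (binomialSeries s n)) (scaled q>0 q<1 s c z lim)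

  zeroFree-linear-times : ∀ s {c z₀} → c ≉ 0# → 1# ≤ z₀ →
    ZeroFreeOnDisc (linearTimes (ι z₀) (λ n → ι c *ᶜ ι (binomialSeries s n)))
  zeroFree-linear-times s {c} {z₀} c≉0 z₀≥1 z z<1 =
    let q , q>0 , q<1 , v , v≉0 , lim = binomial-sum s z z<1
    in (z -ᶜ ι z₀) *ᶜ (ι c *ᶜ v) , *ᶜ-≉0 positive (*ᶜ-≉0 (∣ι∣²-pos c≉0) v≉0) ,
       converges⇒hasSum q>0 q<1 g (converges-linear q>0 q<1 {f = f} {g = g} {z = z} {v = ι c *ᶜ v} (ι z₀)
         (reflᶜ {g 0}) (λ n → reflᶜ {g (suc n)}) (scaled q>0 q<1 s c z lim))
    where
    f g : ℕ → ℂ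
    f n = ι c *ᶜ ι (binomialSeries s n)
    g = linearTimes (ι z₀) f

    re<z₀ : re z < z₀
    re<z₀ = <-≤-trans (≰⇒> λ 1≤re → <⇒≱ z<1
      (≤-by (+-nonneg (*-nonneg (difference-nonneg 1≤re) (+-nonneg (≤-trans (inj₁ 0<1) 1≤re) (inj₁ 0<1))) (square-nonneg (im z)))
        (solve 2 (λ a b → (a :* a :+ b :* b) :- :1 := (a :- :1) :* (a :+ :1) :+ b :* b) refl (re z) (im z)))) z₀≥1

    positive : 0# < ∣ z -ᶜ ι z₀ ∣²
    positive = <-respʳ-≈ (solve 3 (λ a b c → (c :- a) :* (c :- a) :+ b :* b
                                := (a :- c) :* (a :- c) :+ (b :- :0) :* (b :- :0)) refl (re z) (im z) z₀)
      (+-pos-nonneg (*-pos (difference-pos re<z₀) (difference-pos re<z₀)) (square-nonneg (im z)))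

-- The zeros of Eulerian polynomials

module EulerianZeros (em : ExcludedMiddle 0ℓ) (ℝ : CompleteOrderedField) where

  open CompleteOrderedField ℝ renaming (zero to *-zero)
  open Eulerian ℝ
  open OrderedField ℝ
  open CauchyProduct commutativeRing
  open Polynomials ℝ
  open EulerianOperator ℝ
  open BinomialSeries ℝ
  open ComplexNumbers ℝ
  open BinomialSums em ℝ
  open import Relation.Binary.Reasoning.Setoid setoid

  -- Complex and real factorisations

  -- linearTimes multiplies by X - r, hence the sign in front of f.
  linearTimes-real : ∀ r {h f} → (∀ n → h n ≈ᶜ ι (- 1# * f n)) → ∀ n → linearTimes (ι r) h n ≈ᶜ ι (lin r f n)
  linearTimes-real r {h} {f} h≈ zero =
    trans (-‿cong (+-cong (*-congˡ (proj₁ (h≈ 0))) (-‿cong (*-congˡ (proj₂ (h≈ 0))))))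
      (solve 2 (λ r x → :- (r :* (:- :1 :* x) :- :0 :* :0) := r :* x) refl r (f 0)) ,
    trans (-‿cong (+-cong (*-congˡ (proj₂ (h≈ 0))) (*-congˡ (proj₁ (h≈ 0)))))
      (solve 2 (λ r x → :- (r :* :0 :+ :0 :* (:- :1 :* x)) := :0) refl r (f 0))
  linearTimes-real r {h} {f} h≈ (suc n) =
    trans (+-cong (proj₁ (h≈ n)) (-‿cong (+-cong (*-congˡ (proj₁ (h≈ (suc n)))) (-‿cong (*-congˡ (proj₂ (h≈ (suc n))))))))
      (solve 3 (λ r x y → :- :1 :* x :- (r :* (:- :1 :* y) :- :0 :* :0) := r :* y :- x) refl r (f n) (f (suc n))) ,
    trans (+-cong (proj₂ (h≈ n)) (-‿cong (+-cong (*-congˡ (proj₂ (h≈ (suc n)))) (*-congˡ (proj₁ (h≈ (suc n)))))))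
      (solve 3 (λ r x y → :0 :- (r :* :0 :+ :0 :* (:- :1 :* y)) := :0) refl r (f n) (f (suc n)))

  -- The sign accounts for the factors r - X in place of X - r.
  withZeros-real : ∀ rs {g f} → (∀ n → g n ≈ᶜ ι (sgn (length rs) * f n)) →
    ∀ n → withZeros (map ι rs) g n ≈ᶜ ι (lins rs f n)
  withZeros-real [] {g} {f} g≈ n =
    transᶜ {g n} {ι (1# * f n)} {ι (f n)} (g≈ n) (ι-cong (*-identityˡ (f n)))
  withZeros-real (r ∷ rs) {g} {f} g≈ = linearTimes-real r λ n →
    transᶜ {withZeros (map ι rs) g n} {ι (lins rs (λ n → - 1# * f n) n)} {ι (- 1# * lins rs f n)}
      (withZeros-real rs {g} {λ n → - 1# * f n} (λ n →
        transᶜ {g n} {ι (sgn (suc (length rs)) * f n)} {ι (sgn (length rs) * (- 1# * f n))} (g≈ n)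
          (ι-cong (solve 2 (λ s x → :- s :* x := s :* (:- :1 :* x)) refl (sgn (length rs)) (f n)))) n)
      (ι-cong (lins-scale (- 1#) rs f n))


  zerosOf-real : ∀ {m} (p : Poly m) rs {c} → c ≉ 0# → coeff p ≋ lins rs (const c) → ZerosOf p (map ι rs)
  zerosOf-real p rs {c} c≉0 p≋ = ι (sgn k * c) , (λ (e , _) → *-≉0 (sgn-≉0 k) c≉0 e) , λ n →
    transᶜ {ι (coeff p n)} {ι (lins rs (const c) n)} {withZeros (map ι rs) (constant (ι (sgn k * c))) n}
      (ι-cong (p≋ n))
      (symᶜ {withZeros (map ι rs) (constant (ι (sgn k * c))) n} {ι (lins rs (const c) n)}
        (withZeros-real rs {constant (ι (sgn k * c))} {const c}
          (λ { zero → refl , refl ; (suc n) → sym (zeroʳ (sgn k)) , refl }) n))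
    where k = length rs

  -- A strictly increasing list of numbers in (0,1).
  In⟨0,1⟩ : List Carrier → Set
  In⟨0,1⟩ rs = Above 0# rs × All (_< 1#) rs

  realAnd⟨0,1⟩ : ∀ rs → In⟨0,1⟩ rs → All (RealAnd ⟨0,1⟩) (map ι rs)
  realAnd⟨0,1⟩ rs (above , rs<1) = map⁺ (All.zipWith
    (λ { {x} (p , q) → x , (refl , refl) , p , q }) (above⇒all rs above , rs<1))

  -- Here f = g ∏ (r - X), and h is g up to sign.
  discZerosOf-real : ∀ f rs {g h} → In⟨0,1⟩ rs → ZeroFreeOnDisc h → (∀ n → h n ≈ᶜ ι (sgn (length rs) * g n)) →
    f ≋ lins rs g → DiscZerosOf f (map ι rs)
  discZerosOf-real f rs {g} {h} (above , rs<1) zeroFree h≈ f≋ =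
    map⁺ (All.zipWith (λ { {x} (p , q) → <-by
        (*-pos (difference-pos q) (+-pos-nonneg p (inj₁ 0<1)))
        (solve 1 (λ x → :1 :- (x :* x :+ :0 :* :0) := (:1 :- x) :* (x :+ :1)) refl x) }) (above⇒all rs above , rs<1)) ,
    h , zeroFree , λ n → transᶜ {ι (f n)} {ι (lins rs g n)} {withZeros (map ι rs) h n} (ι-cong (f≋ n))
      (symᶜ {withZeros (map ι rs) h n} {ι (lins rs g n)} (withZeros-real rs {h} {g} h≈ n))

  -- The polynomial F

  ev-scale : ∀ k N f x → ev N (λ n → k * f n) x ≈ k * ev N f x
  ev-scale k zero    f x = sym (zeroʳ k)
  ev-scale k (suc N) f x = trans (+-congˡ (*-congˡ (ev-scale k N (f ∘ suc) x)))
    (solve 4 (λ k a x v → k :* a :+ x :* (k :* v) := k :* (a :+ x :* v)) refl k (f 0) x (ev N (f ∘ suc) x))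

  -- The real part of c ∏ (X + αⱼ), which is re c ∏ (X + αⱼ).
  product : ∀ m → (Fin m → Carrier) → ℂ → Seq
  product m α c n = re (withZeros (tabulate (λ j → ι (- α j))) (constant c) n)

  product-suc : ∀ m α c → product (suc m) α c ≋ (λ n → - 1# * lin (- α Fin.zero) (product m (α ∘ Fin.suc) c) n)
  product-suc m α c zero = solve 3 (λ a x y → :- (:- a :* x :- :0 :* y) := :- :1 :* (:- a :* x)) refl
    (α Fin.zero) _ _
  product-suc m α c (suc n) = solve 4 (λ a x y z → z :- (:- a :* x :- :0 :* y) := :- :1 :* (:- a :* x :- z)) refl
    (α Fin.zero) _ _ _

  product-short : ∀ m α c → Short (suc m) (product m α c)
  product-short zero    α c (suc n) _ = refl
  product-short (suc m) α c n m≤n = trans (product-suc m α c n)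
    (trans (*-congˡ (lin-short (- α Fin.zero) (product-short m (α ∘ Fin.suc) c) n m≤n)) (zeroʳ _))

  product-ev : ∀ m α c x → ev (suc m) (product m α c) x ≈ shifts m α x * re c
  product-ev zero α c x = solve 2 (λ c x → c :+ x :* :0 := :1 :* c) refl (re c) x
  product-ev (suc m) α c x = begin
    ev (suc (suc m)) (product (suc m) α c) x
      ≈⟨ ev-cong (suc (suc m)) (product-suc m α c) x ⟩
    ev (suc (suc m)) (λ n → - 1# * lin (- α₀) p n) x
      ≈⟨ trans (ev-scale (- 1#) (suc (suc m)) (lin (- α₀) p) x)
           (*-congˡ (trans (ev-lin (suc m) (- α₀) p (product-short m (α ∘ Fin.suc) c) x)
             (*-congˡ (product-ev m (α ∘ Fin.suc) c x)))) ⟩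
    - 1# * ((- α₀ - x) * (shifts m (α ∘ Fin.suc) x * re c))
      ≈⟨ solve 4 (λ a x s c → :- :1 :* ((:- a :- x) :* (s :* c)) := (a :+ x) :* s :* c) refl α₀ x _ (re c) ⟩
    shifts (suc m) α x * re c ∎
    where
    α₀ = α Fin.zero
    p  = product m (α ∘ Fin.suc) c

  eval-zeros : ∀ {m} (F : Poly m) (α : Fin m → Carrier) →
    (zeros : HasZerosAtNegatives F α) → ∀ x → eval F x ≈ shifts m α x * re (proj₁ zeros)
  eval-zeros {m} F α (c , _ , F≈) x = trans (eval≈ev F x)
    (trans (ev-cong (suc m) (λ n → proj₁ (F≈ n)) x) (product-ev m α c x))

  shifts-pos : ∀ m α → (∀ j → 0# < α j) → 0# < shifts m α 0#
  shifts-pos zero    α α>0 = 0<1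
  shifts-pos (suc m) α α>0 =
    *-pos (+-pos-nonneg (α>0 Fin.zero) ≤-refl) (shifts-pos m (α ∘ Fin.suc) (α>0 ∘ Fin.suc))

  -- The Eulerian polynomial

  abstract
    -- All steps have k + a < 0.
    eulerian-zeros : ∀ a {γ} → 0# < γ → ∀ m α → (∀ j → 0# < α j) → fromℕ m + a < 1# →
      ∃[ c ] ∃[ rs ] (0# < c × In⟨0,1⟩ rs × length rs ≡ m × eulerian a γ m α ≋ lins rs (const c))
    eulerian-zeros a {γ} γ>0 zero α α>0 _ = γ , [] , γ>0 , (tt , []) , ≡.refl , λ _ → refl
    eulerian-zeros a γ>0 (suc m) α α>0 small =
      let c , rs , c>0 , (above , rs<1) , len , e = eulerian-zeros a γ>0 m (α ∘ Fin.suc) (α>0 ∘ Fin.suc) (<-trans s<0 0<1)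
          c′ , ss , c′>0 , above′ , ss<1 , len′ , e′ = step-negative s (α Fin.zero) (α>0 Fin.zero) c>0 above rs<1 s<0
      in c′ , ss , c′>0 , (above′ , ss<1) , ≡.trans len′ (≡.cong suc len) ,
         λ n → trans (step-cong s (α Fin.zero) e n) (e′ n)
      where
      s : Carrier
      s = fromℕ m + a
      s<0 : s < 0#
      s<0 = <-by (difference-pos small) (solve 2 (λ m a → :0 :- (m :+ a) := :1 :- ((:1 :+ m) :+ a)) refl (fromℕ m) a)

    -- All steps but the last one have k + a < 0.
    eulerian-zeros-last : ∀ a {γ} → 0# < γ → ∀ m α → (∀ j → 0# < α j) →
      1# ≤ fromℕ (suc m) + a → fromℕ (suc m) + a < 1# + 1# → a < α Fin.zero →
      ∃[ c ] ∃[ z₀ ] ∃[ ss ] (0# < c × 1# ≤ z₀ × In⟨0,1⟩ ss × eulerian a γ (suc m) α ≋ lins ss (lin z₀ (const c)))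
    eulerian-zeros-last a γ>0 m α α>0 large small a<α₀ =
      let c , rs , c>0 , (above , rs<1) , len , e = eulerian-zeros a γ>0 m (α ∘ Fin.suc) (α>0 ∘ Fin.suc)
            (<-by (difference-pos small) (solve 2 (λ m a → :1 :- (m :+ a) := (:1 :+ :1) :- ((:1 :+ m) :+ a)) refl (fromℕ m) a))
          c′ , z₀ , ss , c′>0 , z₀≥1 , above′ , ss<1 , e′ = step-nonnegative s α₀ (α>0 Fin.zero) c>0 above rs<1
            (≤-by (difference-nonneg large) (solve 2 (λ m a → (m :+ a) :- :0 := ((:1 :+ m) :+ a) :- :1) refl (fromℕ m) a))
            (<-by (difference-pos a<α₀) (trans (+-congˡ (-‿cong (+-congˡ (-‿cong (reflexive (≡.cong fromℕ len))))))
              (solve 3 (λ m a b → :0 :- ((m :+ a) :- b :- m) := b :- a) refl (fromℕ m) a α₀)))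
      in c′ , z₀ , ss , c′>0 , z₀≥1 , (above′ , ss<1) , λ n → trans (step-cong s α₀ e n) (e′ n)
      where
      s α₀ : Carrier
      s = fromℕ m + a
      α₀ = α Fin.zero

  module _ {m} (a : Carrier) (F : Poly m) (α : Fin m → Carrier) (F0≈1 : eval F 0# ≈ 1#)
           (zeros : HasZerosAtNegatives F α) (α>0 : ∀ j → 0# < α j)
           (ŵ : Poly m) (isEulerian : IsEulerian a F ŵ) where

    private
      s = fromℕ m + a
      b = binomialSeries s

    -- The leading coefficient of F.
    γ : Carrier
    γ = re (proj₁ zeros)

    γ-pos : 0# < γ
    γ-pos = *-cancelˡ-pos (shifts-pos m α α>0)
      (<-respʳ-≈ (trans (sym F0≈1) (eval-zeros F α zeros 0#)) 0<1)

    ŵ≋eulerian : coeff ŵ ≋ eulerian a γ m α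
    ŵ≋eulerian = ⊛-cancelʳ (binomialSeries-0 s) (coeff ŵ) (eulerian a γ m α) λ n →
      trans (sym (isEulerian n))
        (trans (*-congʳ (eval-zeros F α zeros (fromℕ n))) (sym (eulerian-⊛ a γ m α n)))

    hypergeometric-factors : ∀ rs {p} → coeff ŵ ≋ lins rs p → hypergeometric a F ≋ lins rs (p ⊛ b)
    hypergeometric-factors rs {p} e n =
      trans (isEulerian n) (trans (⊛-cong {g = b} e (λ _ → refl) n) (lins-⊛ rs p b n))

  ι-scale : ∀ k c x → ι (k * c) *ᶜ ι x ≈ᶜ ι (k * (c * x))
  ι-scale k c x = transᶜ {ι (k * c) *ᶜ ι x} {ι (k * c * x)} {ι (k * (c * x))}
    (symᶜ {ι (k * c * x)} {ι (k * c) *ᶜ ι x} (ι-* (k * c) x)) (ι-cong (*-assoc k c x))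

  zeros-below-one : ∀ m a (F : Poly m) (α : Fin m → Carrier) → eval F 0# ≈ 1# → HasZerosAtNegatives F α →
    (∀ j → 0# < α j) → (ŵ : Poly m) → IsEulerian a F ŵ → a + fromℕ m < 1# →
    ∃[ zs ] (ZerosOf ŵ zs × DiscZerosOf (hypergeometric a F) zs × All (RealAnd ⟨0,1⟩) zs)
  zeros-below-one m a F α F0≈1 zeros α>0 ŵ isEulerian small =
    let γ>0 = γ-pos a F α F0≈1 zeros α>0 ŵ isEulerian
        c , rs , c>0 , inside , _ , e = eulerian-zeros a γ>0 m α α>0 (<-respˡ-≈ (+-comm a (fromℕ m)) small)
        ŵ≋ = λ n → trans (ŵ≋eulerian a F α F0≈1 zeros α>0 ŵ isEulerian n) (e n)
        k = length rs
    in map ι rs , zerosOf-real ŵ rs (>⇒≉ c>0) ŵ≋ ,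
       discZerosOf-real (hypergeometric a F) rs inside
         (zeroFree-constant-times (fromℕ m + a) (*-≉0 (sgn-≉0 k) (>⇒≉ c>0)))
         (λ n → ι-scale (sgn k) c (b n))
         (λ n → trans (hypergeometric-factors a F α F0≈1 zeros α>0 ŵ isEulerian rs ŵ≋ n)
           (lins-cong rs (const-⊛ c b) n)) ,
       realAnd⟨0,1⟩ rs inside
    where b = binomialSeries (fromℕ m + a)

  -- As z₀ ≥ 1, its linear factor belongs to the zero-free part in the disc.
  zeros-below-two : ∀ m a (F : Poly (suc m)) (α : Fin (suc m) → Carrier) → eval F 0# ≈ 1# → HasZerosAtNegatives F α →
    (∀ j → 0# < α j) → (ŵ : Poly (suc m)) → IsEulerian a F ŵ →
    1# ≤ a + fromℕ (suc m) → a + fromℕ (suc m) < 1# + 1# → (∀ j → a < α j) →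
    ∃[ z₀ ] ∃[ zs ] (ZerosOf ŵ (z₀ ∷ zs) × DiscZerosOf (hypergeometric a F) zs ×
                     All (RealAnd ⟨0,1⟩) zs × RealAnd [1,∞⟩ z₀)
  zeros-below-two m a F α F0≈1 zeros α>0 ŵ isEulerian large small a<α =
    let γ>0 = γ-pos a F α F0≈1 zeros α>0 ŵ isEulerian
        c , z₀ , rs , c>0 , z₀≥1 , inside , e = eulerian-zeros-last a γ>0 m α α>0
          (≤-respʳ (+-comm a (fromℕ (suc m))) large) (<-respˡ-≈ (+-comm a (fromℕ (suc m))) small) (a<α Fin.zero)
        ŵ≋ = λ n → trans (ŵ≋eulerian a F α F0≈1 zeros α>0 ŵ isEulerian n) (e n)
        k = length rs
    in ι z₀ , map ι rs ,
       zerosOf-real ŵ (z₀ ∷ rs) (>⇒≉ c>0) (λ n → trans (ŵ≋ n) (lins-comm rs z₀ (const c) n)) ,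
       discZerosOf-real (hypergeometric a F) rs inside
         (zeroFree-linear-times (fromℕ (suc m) + a) (*-≉0 (sgn-≉0 (suc k)) (>⇒≉ c>0)) z₀≥1)
         (λ n → transᶜ {linearTimes (ι z₀) (λ n → ι (sgn (suc k) * c) *ᶜ ι (b n)) n}
                  {ι (lin z₀ (λ n → sgn k * (c * b n)) n)} {ι (sgn k * lin z₀ (λ n → c * b n) n)}
           (linearTimes-real z₀ {λ n → ι (sgn (suc k) * c) *ᶜ ι (b n)} {λ n → sgn k * (c * b n)}
             (λ n → transᶜ {ι (sgn (suc k) * c) *ᶜ ι (b n)} {ι (sgn (suc k) * (c * b n))} {ι (- 1# * (sgn k * (c * b n)))}
               (ι-scale (sgn (suc k)) c (b n))
               (ι-cong (solve 2 (λ s x → :- s :* x := :- :1 :* (s :* x)) refl (sgn k) (c * b n)))) n)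
           (ι-cong (lin-scale (sgn k) z₀ (λ n → c * b n) n)))
         (λ n → trans (hypergeometric-factors a F α F0≈1 zeros α>0 ŵ isEulerian rs ŵ≋ n)
           (lins-cong rs (λ n → trans (lin-⊛ z₀ (const c) b n) (lin-cong z₀ (const-⊛ c b) n)) n)) ,
       realAnd⟨0,1⟩ rs inside , z₀ , (refl , refl) , z₀≥1
    where b = binomialSeries (fromℕ (suc m) + a)

theorem3 : ExcludedMiddle 0ℓ →
    (ℝ : CompleteOrderedField) →
    let open CompleteOrderedField ℝ
        open Eulerian ℝ
    in
    (m : ℕ) → 1 ℕ.≤ m →
    (a : Carrier) (F : Poly m) (α : Fin m → Carrier) →
    ExactDegree m F → eval F 0# ≈ 1# → HasZerosAtNegatives F α →
    (∀ j → 0# < α j) →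
    (ŵ : Poly m) → IsEulerian a F ŵ →
    (a + fromℕ m < 1# →
      ∃[ zs ] (ZerosOf ŵ zs × DiscZerosOf (hypergeometric a F) zs ×
               All (RealAnd ⟨0,1⟩) zs))
    ×
    -- The last hypothesis is automatic for 2 ≤ m, where a < 0; for m = 1 and
    -- a ≥ α₁ the conclusion fails, as then ŵ = 1 + (a/α₁ − 1) x.
    (1# ≤ a + fromℕ m → a + fromℕ m < 1# + 1# → (∀ j → a < α j) →
      ∃[ z₀ ] ∃[ zs ] (ZerosOf ŵ (z₀ ∷ zs) × DiscZerosOf (hypergeometric a F) zs ×
                       All (RealAnd ⟨0,1⟩) zs × RealAnd [1,∞⟩ z₀))
theorem3 em ℝ (suc m) _ a F α _ F0≈1 zeros α>0 ŵ isEulerian =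
  zeros-below-one (suc m) a F α F0≈1 zeros α>0 ŵ isEulerian ,
  zeros-below-two m a F α F0≈1 zeros α>0 ŵ isEulerian
  where open EulerianZeros em ℝ
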